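{- Define polynomials $F_s(r)$ by $F_0(r)=F_1(r)=1$ and $F_s(r)=(1+r+2r^2)F_{s-1}(r)+r^3F_{s-2}(r)$ for $s\geq 2$. Then for all integers $s\geq 1$, we have $$\mathrm{EN}_{s,3}(2143)(q)=q^{9\binom{s}{2}}F_s(1/q).$$
   Context: For integers $s,t\ge 1$, $\mathrm{EN}_{s,t}$ is the rectangular poset on the label set $\{1,\ldots,st\}$ whose labels are arranged in $s$ rows of length $t$, row $i$ (for $0\le i\le s-1$) being $it+1,it+2,\ldots,it+t$, and whose order is generated by the relations $it+j<_{\mathrm{EN}} it+j+1$ for $0\le i\le s-1$, $1\le j\le t-1$, and $(i+1)t+j<_{\mathrm{EN}} it+j$ for $0\le i\le s-2$, $1\le j\le t$. A linear extension of $\mathrm{EN}_{s,t}$ is viewed as a permutation $\pi=\pi_1\cdots\pi_{st}\in S_{st}$ of the labels in which $a$ appears before $b$ whenever $a<_{\mathrm{EN}}b$. For example, the linear extensions of $\mathrm{EN}_{3,2}$ are $531642,536142,536412,563142,563412$. A permutation $\sigma=\sigma_1\cdots\sigma_n$ contains the pattern $\tau=\tau_1\cdots\tau_m\in S_m$ if there are indices $i_1<\cdots<i_m$ such that for all $j,l\in\{1,\ldots,m\}$ one has $\sigma_{i_j}<\sigma_{i_l}$ if and only if $\tau_j<\tau_l$; otherwise $\sigma$ avoids $\tau$. $\mathrm{EN}_{s,t}(\tau)$ is the set of linear extensions of $\mathrm{EN}_{s,t}$ that avoid $\tau$. An inversion of $\pi$ is a pair $(i,j)$ with $i<j$ and $\pi_i>\pi_j$,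 and $\mathrm{inv}(\pi)$ is the number of inversions of $\pi$. Finally, $\mathrm{EN}_{s,t}(\tau)(q)=\sum_{\pi\in \mathrm{EN}_{s,t}(\tau)}q^{\mathrm{inv}(\pi)}$. -}

module Defs where

open import Data.Bool.Base using (if_then_else_)
open import Data.Fin.Base using (Fin; toℕ; combine; _<_)
import Data.Fin.Properties as Fin
open import Data.Fin.Patterns using (0F; 1F; 2F; 3F)
open import Data.Integer.Base as ℤ using (ℤ; 0ℤ; 1ℤ; +_)
import Data.Integer.Properties as ℤ
open import Data.List.Base as List
  using (List; []; _∷_; _++_; [_]; allFin; cartesianProduct; cartesianProductWith; filter; foldr; length)
open import Data.List.Membership.Propositional using (_∈_; lose)
open import Data.List.Membership.Propositional.Properties
  using (∈-allFin; ∈-cartesianProductWith⁺)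
open import Data.List.Relation.Unary.Any as Any using (here; satisfied)
open import Data.Nat.Base as ℕ using (ℕ; zero; suc)
import Data.Nat.Properties as ℕ
open import Data.Product.Base using (_×_; _,_; ∃; ∃₂; proj₁; proj₂)
open import Data.Vec.Base as Vec using (Vec; []; _∷_; lookup)
open import Function.Base using (_∘_)
open import Function.Bundles using (_⇔_; mk⇔; Equivalence)
open import Function.Consequences.Propositional
  using (strictlySurjective⇒surjective; surjective⇒strictlySurjective)
open import Function.Definitions using (Injective; Bijective)
open import Level using (0ℓ)
open import Relation.Binary.Core using (Rel)
open import Relation.Binary.Construct.Closure.Transitive using (TransClosure) renaming ([_] to [_]⁺; _∷_ to _∷⁺_)
open import Relation.Binary.PropositionalEquality using (_≡_; refl; sym; trans; subst)
open import Relation.Nullary.Decidable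
  using (Dec; does; map′; _×-dec_; _→-dec_; ¬?)
open import Relation.Nullary.Negation using (¬_)

-- Words of length m over n letters.  A permutation of {1,…,n} is written in
-- one-line notation as a Word n n, and the letter x ∈ {1,…,n} is represented by
-- the element of Fin n whose toℕ is x - 1.

Word : ℕ → ℕ → Set
Word m n = Vec (Fin n) m

words : ∀ m n → List (Word m n)
words zero    n = [ [] ]
words (suc m) n = cartesianProductWith _∷_ (allFin n) (words m n)

∈-words : ∀ {m n} (w : Word m n) → w ∈ words m n
∈-words []      = here refl
∈-words (x ∷ w) = ∈-cartesianProductWith⁺ _∷_ (∈-allFin x) (∈-words w)

anyWord? : ∀ {m n} {P : Word m n → Set} → (∀ w → Dec (P w)) → Dec (∃ P)
anyWord? {m} {n} P? =
  map′ satisfied (λ (w , p) → lose (∈-words w) p) (Any.any? P? (words m n))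

IsPermutation : ∀ {n} → Word n n → Set
IsPermutation π = Bijective _≡_ _≡_ (lookup π)

isPermutation? : ∀ {n} (π : Word n n) → Dec (IsPermutation π)
isPermutation? π =
  map′ (λ (inj , surj) → (λ {i} {j} → inj i j) , strictlySurjective⇒surjective surj)
       (λ (inj , surj) → (λ i j → inj) , surjective⇒strictlySurjective surj)
       ((Fin.all? λ i → Fin.all? λ j →
           (lookup π i Fin.≟ lookup π j) →-dec (i Fin.≟ j))
        ×-dec
        (Fin.all? λ x → Fin.any? λ i → lookup π i Fin.≟ x))

Before : ∀ {m n} → Word m n → Fin n → Fin n → Set
Before π a b = ∃₂ λ i j → i < j × lookup π i ≡ a × lookup π j ≡ b

before? : ∀ {m n} (π : Word m n) (a b : Fin n) → Dec (Before π a b)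
before? π a b = Fin.any? λ i → Fin.any? λ j →
  (i Fin.<? j) ×-dec (lookup π i Fin.≟ a) ×-dec (lookup π j Fin.≟ b)

-- With rows i and columns j counted from 0, combine i j has toℕ equal to
-- t * toℕ i + toℕ j, so it represents the label it + (j + 1).

data ENGen (s t : ℕ) : Rel (Fin (s ℕ.* t)) 0ℓ where
  row    : ∀ (i : Fin s) (j j′ : Fin t) → toℕ j′ ≡ suc (toℕ j) →
           ENGen s t (combine i j) (combine i j′)
  column : ∀ (i i′ : Fin s) (j : Fin t) → toℕ i′ ≡ suc (toℕ i) →
           ENGen s t (combine i′ j) (combine i j)

EN< : ∀ s t → Rel (Fin (s ℕ.* t)) 0ℓ
EN< s t = TransClosure (ENGen s t)

IsLinearExtension : ∀ s t → Word (s ℕ.* t) (s ℕ.* t) → Set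
IsLinearExtension s t π =
  IsPermutation π × (∀ {a b} → EN< s t a b → Before π a b)

isLinearExtension? : ∀ s t (π : Word (s ℕ.* t) (s ℕ.* t)) →
                     Dec (IsLinearExtension s t π)
isLinearExtension? s t π =
  map′ to from (isPermutation? π ×-dec rows? ×-dec columns?)
  where
  Rows Columns : Set
  Rows    = ∀ (i : Fin s) (j j′ : Fin t) → toℕ j′ ≡ suc (toℕ j) →
            Before π (combine i j) (combine i j′)
  Columns = ∀ (i i′ : Fin s) (j : Fin t) → toℕ i′ ≡ suc (toℕ i) →
            Before π (combine i′ j) (combine i j)

  rows? : Dec Rows
  rows? = Fin.all? λ i → Fin.all? λ j → Fin.all? λ j′ →
    (toℕ j′ ℕ.≟ suc (toℕ j)) →-dec before? π (combine i j) (combine i j′)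

  columns? : Dec Columns
  columns? = Fin.all? λ i → Fin.all? λ i′ → Fin.all? λ j →
    (toℕ i′ ℕ.≟ suc (toℕ i)) →-dec before? π (combine i′ j) (combine i j)

  to : IsPermutation π × Rows × Columns → IsLinearExtension s t π
  to (perm , rows , columns) = perm , extends
    where
    before-trans : ∀ {a b c} → Before π a b → Before π b c → Before π a c
    before-trans (i , j , i<j , πi , πj) (k , l , k<l , πk , πl) =
      i , l , Fin.<-trans i<j (subst (_< l) (proj₁ perm (trans πk (sym πj))) k<l) , πi , πl

    gen : ∀ {a b} → ENGen s t a b → Before π a b
    gen (row i j j′ eq)    = rows i j j′ eq
    gen (column i i′ j eq) = columns i i′ j eq

    extends : ∀ {a b} → EN< s t a b → Before π a b
    extends [ a<b ]⁺     = gen a<b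
    extends (a<b ∷⁺ b<c) = before-trans (gen a<b) (extends b<c)

  from : IsLinearExtension s t π → IsPermutation π × Rows × Columns
  from (perm , extends) =
    perm ,
    (λ i j j′ eq → extends [ row i j j′ eq ]⁺) ,
    (λ i i′ j eq → extends [ column i i′ j eq ]⁺)

-- e lists the positions i₁ < ⋯ < iₘ of an occurrence of τ in σ.

IsOccurrence : ∀ {m n} → Word m m → Word n n → Word m n → Set
IsOccurrence τ σ e =
  (∀ j l → j < l → lookup e j < lookup e l) ×
  (∀ j l → (lookup σ (lookup e j) < lookup σ (lookup e l)) ⇔ (lookup τ j < lookup τ l))

Contains : ∀ {m n} → Word m m → Word n n → Set
Contains τ σ = ∃ (IsOccurrence τ σ)

Avoids : ∀ {m n} → Word m m → Word n n → Set
Avoids τ σ = ¬ Contains τ σ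

avoids? : ∀ {m n} (τ : Word m m) (σ : Word n n) → Dec (Avoids τ σ)
avoids? τ σ = ¬? (anyWord? λ e →
  (Fin.all? λ j → Fin.all? λ l → (j Fin.<? l) →-dec (lookup e j Fin.<? lookup e l))
  ×-dec
  (Fin.all? λ j → Fin.all? λ l →
    (lookup σ (lookup e j) Fin.<? lookup σ (lookup e l)) ⇔-dec
    (lookup τ j Fin.<? lookup τ l)))
  where
  _⇔-dec_ : ∀ {A B : Set} → Dec A → Dec B → Dec (A ⇔ B)
  A? ⇔-dec B? = map′ (λ (f , g) → mk⇔ f g)
                     (λ A⇔B → Equivalence.to A⇔B , Equivalence.from A⇔B)
                     ((A? →-dec B?) ×-dec (B? →-dec A?))

pattern2143 : Word 4 4
pattern2143 = 1F ∷ 0F ∷ 3F ∷ 2F ∷ []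

-- The list words m n has no repetitions, so neither does the list EN s t τ.

EN : ∀ {m} s t → Word m m → List (Word (s ℕ.* t) (s ℕ.* t))
EN s t τ = filter (λ π → isLinearExtension? s t π ×-dec avoids? τ π)
                  (words (s ℕ.* t) (s ℕ.* t))

inv : ∀ {n} → Word n n → ℕ
inv {n} π = length (filter (λ (i , j) → (i Fin.<? j) ×-dec (lookup π j Fin.<? lookup π i))
                           (cartesianProduct (allFin n) (allFin n)))

-- ℤ[q,q⁻¹] as formal sums of terms: (c , e) stands for c qᵉ.  Terms with the
-- same exponent may be repeated, and _≈_ compares the total coefficients.

Laurent : Set
Laurent = List (ℤ × ℤ)

coefficient : Laurent → ℤ → ℤ
coefficient f e =
  foldr (λ (c , d) acc → if does (d ℤ.≟ e) then c ℤ.+ acc else acc) 0ℤ f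

infix 4 _≈_
_≈_ : Rel Laurent 0ℓ
f ≈ g = ∀ e → coefficient f e ≡ coefficient g e

infixl 6 _+ᴸ_
_+ᴸ_ : Laurent → Laurent → Laurent
_+ᴸ_ = _++_

infixl 7 _*ᴸ_
_*ᴸ_ : Laurent → Laurent → Laurent
_*ᴸ_ = cartesianProductWith (λ (c , d) (c′ , d′) → c ℤ.* c′ , d ℤ.+ d′)

constant : ℤ → Laurent
constant c = [ (c , 0ℤ) ]

q^_ : ℤ → Laurent
q^ e = [ (1ℤ , e) ]

sumᴸ : List Laurent → Laurent
sumᴸ = foldr _+ᴸ_ []

EN-poly : ∀ {m} s t → Word m m → Laurent
EN-poly s t τ = sumᴸ (List.map (λ π → q^ (+ inv π)) (EN s t τ))

-- ℤ[r] as coefficient lists, constant coefficient first.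

Polynomial : Set
Polynomial = List ℤ

infixl 6 _+ᴾ_
_+ᴾ_ : Polynomial → Polynomial → Polynomial
[]      +ᴾ g       = g
(a ∷ f) +ᴾ []      = a ∷ f
(a ∷ f) +ᴾ (b ∷ g) = a ℤ.+ b ∷ f +ᴾ g

infixl 7 _*ᴾ_
_*ᴾ_ : Polynomial → Polynomial → Polynomial
[]      *ᴾ g = []
(a ∷ f) *ᴾ g = List.map (a ℤ.*_) g +ᴾ (0ℤ ∷ f *ᴾ g)

evaluate : Polynomial → Laurent → Laurent
evaluate []      x = []
evaluate (a ∷ f) x = constant a +ᴸ x *ᴸ evaluate f x

F : ℕ → Polynomial
F 0             = [ 1ℤ ]
F 1             = [ 1ℤ ]
F (suc (suc s)) = (+ 1 ∷ + 1 ∷ + 2 ∷ []) *ᴾ F (suc s)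
               +ᴾ (+ 0 ∷ + 0 ∷ + 0 ∷ + 1 ∷ []) *ᴾ F s

-- Avoiding 2143 forces row i + 2 to be finished before row i starts: otherwise
-- the first cells of rows i + 1 and i and the last cells of rows i + 2 and i + 1
-- form 2143.  Conversely an occurrence badc needs row(a) < row(b) ≤ row(c) < row(d),
-- so that d, at least two rows above a, precedes it.  Hence at most two adjacent
-- rows are in progress at any time, the extensions are the runs of an automaton,
-- and the transfer matrix of the automaton yields the recurrence of F.

module Submission where

open import Defs
open import Data.Bool.Base using (true; false)
open import Data.Fin.Base as Fin using (Fin; toℕ; combine; remQuot; fromℕ<)
open import Data.Fin.Patterns using (0F; 1F; 2F; 3F)
import Data.Fin.Properties as Fin
open import Data.Integer.Base as ℤ using (ℤ; 0ℤ; 1ℤ; -1ℤ; +_)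
import Data.Integer.Properties as ℤ
open import Data.Integer.Tactic.RingSolver using (solve-∀)
open import Data.List.Base
  using (List; []; _∷_; _++_; map; concat; filter; length; tabulate; allFin; cartesianProduct)
open import Data.List.Membership.Propositional using (_∈_)
open import Data.List.Membership.Propositional.Properties
  using (∈-map⁺; ∈-map⁻; ∈-concat⁺′; ∈-concat⁻′; ∈-tabulate⁺; ∈-tabulate⁻; ∈-filter⁺; ∈-filter⁻)
open import Data.List.Membership.Propositional.Properties.WithK using (unique∧set⇒bag)
import Data.List.Properties as List
open import Data.List.Relation.Binary.BagAndSetEquality using (∼bag⇒↭)
open import Data.List.Relation.Binary.Disjoint.Propositional using (Disjoint)
open import Data.List.Relation.Binary.Permutation.Propositional as ↭
  using (_↭_; refl; prep; swap; ↭-refl; ↭-sym; ↭-trans; ↭⇒↭ₛ)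
open import Data.List.Relation.Binary.Permutation.Propositional.Properties
  using (∈-resp-↭; ↭-length; drop-∷; filter-↭; map⁺)
import Data.List.Relation.Binary.Permutation.Setoid.Properties as Setoid
open import Data.List.Relation.Unary.All as All using (All; []; _∷_)
import Data.List.Relation.Unary.All.Properties as All
open import Data.List.Relation.Unary.AllPairs as AllPairs using (AllPairs; []; _∷_)
import Data.List.Relation.Unary.AllPairs.Properties as AllPairs
open import Data.List.Relation.Unary.Any using (here; there)
open import Data.List.Relation.Unary.Unique.Propositional using (Unique)
import Data.List.Relation.Unary.Unique.Propositional.Properties as Unique
open import Data.Nat.Base as ℕ using (ℕ; zero; suc; _+_; _*_; _≤_; _<_; z≤n; s≤s; z<s; s<s)
open import Data.Nat.Combinatorics using (_C_; nC1≡n; nCk+nC[k+1]≡[n+1]C[k+1])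
import Data.Nat.Properties as ℕ
open import Data.Product.Base using (_×_; _,_; ∃; ∃₂; proj₁; proj₂)
open import Data.Sum.Base using (_⊎_; inj₁; inj₂)
open import Data.Vec.Base using (Vec; []; _∷_; lookup)
import Data.Vec.Properties as Vec
open import Function.Base using (_∘_; id)
open import Function.Bundles using (mk⇔; Equivalence)
open import Relation.Binary.Construct.Closure.Transitive using () renaming ([_] to [_]⁺; _∷_ to _∷⁺_)
open import Relation.Binary.Definitions using (tri<; tri≈; tri>)
open import Relation.Binary.PropositionalEquality
  using (_≡_; _≢_; _≗_; refl; sym; trans; cong; cong₂; subst; subst₂; setoid; module ≡-Reasoning)
open import Relation.Nullary.Decidable using (_×-dec_; does; does-⇔)
open import Relation.Nullary.Negation using (¬_; contradiction)
open import Relation.Unary using (Decidable)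

-- The automaton of 2143-avoiding linear extensions

-- Two relations link words to the automaton. `Gen` is kept small: it is what a word must be known
-- to respect in order to be a run. `Prec` is larger: it is what every run is shown to respect, and
-- with `far` it is strong enough to exclude the pattern. Avoiding words respect `Gen` and words
-- respecting `Prec` avoid the pattern, so both directions close. Inversions fit the automaton
-- because the letters still to come are fixed by the state: each move has a weight, the number of
-- smaller cells left. These weights grow with the row number, so the transfer matrix is not
-- constant in `q`. Dividing by the power of `q` of the run whose rows never overlap leaves a
-- constant matrix in `r = 1/q`. The `P` states are eliminated along the way, so the matrix is 2 by
-- 2, and Cayley-Hamilton gives the two-term recurrence with trace `1+r+2r²` and determinant `-r³`.

Cell : Set
Cell = ℕ × Fin 3

-- The generating relations of EN_{s,3}, together with the only further
-- constraint that avoiding 2143 imposes (constructor skip).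
data Gen : Cell → Cell → Set where
  row    : ∀ {i j j′} → toℕ j′ ≡ suc (toℕ j) → Gen (i , j) (i , j′)
  column : ∀ {i j} → Gen (suc i , j) (i , j)
  skip   : ∀ {i} → Gen (suc (suc i) , 2F) (i , 0F)

-- `row` covers every pair within a row, as `inversion⇒row` requires. No transitivity is built in:
-- longer chains of the order are composed on the side of words, by `before-trans`.
data Prec : Cell → Cell → Set where
  row    : ∀ {i j j′} → j Fin.< j′ → Prec (i , j) (i , j′)
  column : ∀ {i j} → Prec (suc i , j) (i , j)
  far    : ∀ {i i′ j j′} → suc (suc i) ≤ i′ → Prec (i′ , j′) (i , j)

-- The cells not yet written, given by the function remaining.  In E n exactly
-- the rows below n are left.  A₁ n and A₂ n have one resp. two cells of row n
-- written as well, and Pₐᵦ n has a cells of row n + 1 and b cells of row n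
-- written.  A₁ and A₂ may start the next row early, which leads to P.
data State : Set where
  E A₁ A₂ P₁₁ P₂₁ P₂₂ : ℕ → State

below : ℕ → List Cell
below zero    = []
below (suc n) = (n , 0F) ∷ (n , 1F) ∷ (n , 2F) ∷ below n

remaining : State → List Cell
remaining (E n)   = below n
remaining (A₁ n)  = (n , 1F) ∷ (n , 2F) ∷ below n
remaining (A₂ n)  = (n , 2F) ∷ below n
remaining (P₁₁ n) = (suc n , 1F) ∷ (suc n , 2F) ∷ (n , 1F) ∷ (n , 2F) ∷ below n
remaining (P₂₁ n) = (suc n , 2F) ∷ (n , 1F) ∷ (n , 2F) ∷ below n
remaining (P₂₂ n) = (suc n , 2F) ∷ (n , 2F) ∷ below n

moves : State → List (Cell × State)
moves (E zero)     = []
moves (E (suc n))  = ((n , 0F) , A₁ n) ∷ []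
moves (A₁ zero)    = ((0 , 1F) , A₂ 0) ∷ []
moves (A₁ (suc n)) = ((suc n , 1F) , A₂ (suc n)) ∷ ((n , 0F) , P₁₁ n) ∷ []
moves (A₂ zero)    = ((0 , 2F) , E 0) ∷ []
moves (A₂ (suc n)) = ((suc n , 2F) , E (suc n)) ∷ ((n , 0F) , P₂₁ n) ∷ []
moves (P₁₁ n)      = ((suc n , 1F) , P₂₁ n) ∷ []
moves (P₂₁ n)      = ((suc n , 2F) , A₁ n) ∷ ((n , 1F) , P₂₂ n) ∷ []
moves (P₂₂ n)      = ((suc n , 2F) , A₂ n) ∷ []

data Run : State → List Cell → Set where
  []  : Run (E 0) []
  _∷_ : ∀ {S S′ x w} → (x , S′) ∈ moves S → Run S′ w → Run S (x ∷ w)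

data Precedes (a b : Cell) : List Cell → Set where
  here  : ∀ {w} → b ∈ w → Precedes a b (a ∷ w)
  there : ∀ {x w} → Precedes a b w → Precedes a b (x ∷ w)

∈-below⇒< : ∀ n {i j} → (i , j) ∈ below n → i < n
∈-below⇒< (suc n) (here refl)                 = ℕ.≤-refl
∈-below⇒< (suc n) (there (here refl))         = ℕ.≤-refl
∈-below⇒< (suc n) (there (there (here refl))) = ℕ.≤-refl
∈-below⇒< (suc n) (there (there (there p)))   = ℕ.m<n⇒m<1+n (∈-below⇒< n p)

<⇒∈-below : ∀ n {i} j → i < n → (i , j) ∈ below n
<⇒∈-below (suc n) {i} j i<1+n with ℕ.m≤n⇒m<n∨m≡n (ℕ.≤-pred i<1+n)
<⇒∈-below (suc n) j  _ | inj₁ i<n  = there (there (there (<⇒∈-below n j i<n)))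
<⇒∈-below (suc n) 0F _ | inj₂ refl = here refl
<⇒∈-below (suc n) 1F _ | inj₂ refl = there (here refl)
<⇒∈-below (suc n) 2F _ | inj₂ refl = there (there (here refl))

below-unique : ∀ n → Unique (below n)
below-unique zero    = []
below-unique (suc n) =
  ((λ ()) ∷ (λ ()) ∷ fresh) ∷ ((λ ()) ∷ fresh) ∷ fresh ∷ below-unique n
  where
  fresh : ∀ {j} → All ((n , j) ≢_) (below n)
  fresh = All.tabulate λ p → λ { refl → ℕ.<-irrefl refl (∈-below⇒< n p) }

length-below : ∀ n → length (below n) ≡ n * 3
length-below zero    = refl
length-below (suc n) = cong (_+_ 3) (length-below n)

moves-↭aining : ∀ S {x S′} → (x , S′) ∈ moves S → remaining S ↭ x ∷ remaining S′
moves-↭aining (E (suc n))  (here refl)         = ↭-refl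
moves-↭aining (A₁ zero)    (here refl)         = ↭-refl
moves-↭aining (A₁ (suc n)) (here refl)         = ↭-refl
moves-↭aining (A₁ (suc n)) (there (here refl)) =
  ↭-trans (prep _ (swap _ _ refl)) (swap _ _ refl)
moves-↭aining (A₂ zero)    (here refl)         = ↭-refl
moves-↭aining (A₂ (suc n)) (here refl)         = ↭-refl
moves-↭aining (A₂ (suc n)) (there (here refl)) = swap _ _ refl
moves-↭aining (P₁₁ n)      (here refl)         = ↭-refl
moves-↭aining (P₂₁ n)      (here refl)         = ↭-refl
moves-↭aining (P₂₁ n)      (there (here refl)) = swap _ _ refl
moves-↭aining (P₂₂ n)      (here refl)         = ↭-refl

moves-distinct : ∀ S → AllPairs (λ (x , _) (y , _) → x ≢ y) (moves S)
moves-distinct (E zero)     = []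
moves-distinct (E (suc n))  = [] ∷ []
moves-distinct (A₁ zero)    = [] ∷ []
moves-distinct (A₁ (suc n)) = ((λ ()) ∷ []) ∷ [] ∷ []
moves-distinct (A₂ zero)    = [] ∷ []
moves-distinct (A₂ (suc n)) = ((λ ()) ∷ []) ∷ [] ∷ []
moves-distinct (P₁₁ n)      = [] ∷ []
moves-distinct (P₂₁ n)      = ((λ ()) ∷ []) ∷ [] ∷ []
moves-distinct (P₂₂ n)      = [] ∷ []

low⇒¬prec : ∀ {i i′ j j′} → i′ < i → ¬ Prec (i′ , j′) (i , j)
low⇒¬prec i<i      (row _)    = ℕ.<-irrefl refl i<i
low⇒¬prec 1+i<i    column     = ℕ.<-asym 1+i<i ℕ.≤-refl
low⇒¬prec i′<i     (far 2+i≤) = ℕ.<-asym i′<i (ℕ.<-trans ℕ.≤-refl 2+i≤)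

right⇒¬prec : ∀ {i j j′} → j Fin.≤ j′ → ¬ Prec (i , j′) (i , j)
right⇒¬prec j≤j′ (row j′<j) = ℕ.<⇒≱ j′<j j≤j′
right⇒¬prec _    (far 2+i≤) = ℕ.<⇒≱ 2+i≤ (ℕ.n≤1+n _)

above⇒¬prec : ∀ {i j j′} → j ≢ j′ → ¬ Prec (suc i , j′) (i , j)
above⇒¬prec j≢j′ column     = j≢j′ refl
above⇒¬prec _    (far 2+i≤) = ℕ.<-irrefl refl 2+i≤

below⇒¬prec : ∀ {m i a j} → m ≤ i → a ∈ below m → ¬ Prec a (i , j)
below⇒¬prec {m} m≤i p = low⇒¬prec (ℕ.<-≤-trans (∈-below⇒< m p) m≤i)

-- Every remaining cell lies in the row of `x` and not to its left, or in a lower row, or in the row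
-- just above in another column. `Prec` relates none of these to `x`.
moves-minimal : ∀ S {x S′} → (x , S′) ∈ moves S → All (λ a → ¬ Prec a x) (remaining S)
moves-minimal S m = All.tabulate (go S m)
  where
  go : ∀ S {a x S′} → (x , S′) ∈ moves S → a ∈ remaining S → ¬ Prec a x
  go (E (suc n))  (here refl)         (here refl)                 = right⇒¬prec z≤n
  go (E (suc n))  (here refl)         (there (here refl))         = right⇒¬prec z≤n
  go (E (suc n))  (here refl)         (there (there (here refl))) = right⇒¬prec z≤n
  go (E (suc n))  (here refl)         (there (there (there p)))   = below⇒¬prec ℕ.≤-refl p
  go (A₁ zero)    (here refl)         (here refl)                 = right⇒¬prec ℕ.≤-refl
  go (A₁ zero)    (here refl)         (there (here refl))         = right⇒¬prec (s≤s z≤n)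
  go (A₁ (suc n)) (here refl)         (here refl)                 = right⇒¬prec ℕ.≤-refl
  go (A₁ (suc n)) (here refl)         (there (here refl))         = right⇒¬prec (s≤s z≤n)
  go (A₁ (suc n)) (here refl)         (there (there p))           = below⇒¬prec ℕ.≤-refl p
  go (A₁ (suc n)) (there (here refl)) (here refl)                 = above⇒¬prec λ ()
  go (A₁ (suc n)) (there (here refl)) (there (here refl))         = above⇒¬prec λ ()
  -- Past the cells of row `suc n`, what remains is what `E (suc n)` has left, and that state offers
  -- the same cell.
  go (A₁ (suc n)) (there (here refl)) (there (there p))           = go (E (suc n)) (here refl) p
  go (A₂ zero)    (here refl)         (here refl)                 = right⇒¬prec ℕ.≤-refl
  go (A₂ (suc n)) (here refl)         (here refl)                 = right⇒¬prec ℕ.≤-refl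
  go (A₂ (suc n)) (here refl)         (there p)                   = below⇒¬prec ℕ.≤-refl p
  go (A₂ (suc n)) (there (here refl)) (here refl)                 = above⇒¬prec λ ()
  go (A₂ (suc n)) (there (here refl)) (there p)                   = go (E (suc n)) (here refl) p
  go (P₁₁ n)      (here refl)         (here refl)                 = right⇒¬prec ℕ.≤-refl
  go (P₁₁ n)      (here refl)         (there (here refl))         = right⇒¬prec (s≤s z≤n)
  go (P₁₁ n)      (here refl)         (there (there (here refl))) = low⇒¬prec ℕ.≤-refl
  go (P₁₁ n)      (here refl)         (there (there (there (here refl)))) = low⇒¬prec ℕ.≤-refl
  go (P₁₁ n)      (here refl)         (there (there (there (there p)))) = below⇒¬prec (ℕ.n≤1+n n) p
  go (P₂₁ n)      (here refl)         (here refl)                 = right⇒¬prec ℕ.≤-refl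
  go (P₂₁ n)      (here refl)         (there (here refl))         = low⇒¬prec ℕ.≤-refl
  go (P₂₁ n)      (here refl)         (there (there (here refl))) = low⇒¬prec ℕ.≤-refl
  go (P₂₁ n)      (here refl)         (there (there (there p)))   = below⇒¬prec (ℕ.n≤1+n n) p
  go (P₂₁ n)      (there (here refl)) (here refl)                 = above⇒¬prec λ ()
  go (P₂₁ n)      (there (here refl)) (there (here refl))         = right⇒¬prec ℕ.≤-refl
  go (P₂₁ n)      (there (here refl)) (there (there (here refl))) = right⇒¬prec (s≤s z≤n)
  go (P₂₁ n)      (there (here refl)) (there (there (there p)))   = below⇒¬prec ℕ.≤-refl p
  go (P₂₂ n)      (here refl)         (here refl)                 = right⇒¬prec ℕ.≤-refl
  go (P₂₂ n)      (here refl)         (there (here refl))         = low⇒¬prec ℕ.≤-refl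
  go (P₂₂ n)      (here refl)         (there (there p))           = below⇒¬prec (ℕ.n≤1+n n) p

Blocked : List Cell → Cell → Set
Blocked l x = ∃ λ a → a ∈ l × Gen a x

blocked-there : ∀ {y l x} → Blocked l x → Blocked (y ∷ l) x
blocked-there (a , p , a<x) = a , there p , a<x

-- In the highest row each cell after the first waits for its left neighbour; a cell of a lower row
-- waits for the cell of its column one row up.
∈-below⇒first⊎blocked : ∀ n {x} → x ∈ below n →
                        (∃ λ m → n ≡ suc m × x ≡ (m , 0F)) ⊎ Blocked (below n) x
∈-below⇒first⊎blocked (suc n) (here refl)                 = inj₁ (n , refl , refl)
∈-below⇒first⊎blocked (suc n) (there (here refl))         = inj₂ (_ , here refl , row refl)
∈-below⇒first⊎blocked (suc n) (there (there (here refl))) = inj₂ (_ , there (here refl) , row refl)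
∈-below⇒first⊎blocked (suc n) {i , j} (there (there (there p))) =
  inj₂ (_ , <⇒∈-below (suc n) j (s≤s (∈-below⇒< n p)) , column)

-- Pattern avoidance enters the automaton here: while row `suc n` is unfinished, `skip` keeps the
-- highest row of `below n` from being opened as a third one.
∈-below⇒skip⊎blocked : ∀ n {x l} → x ∈ below n → Blocked ((suc n , 2F) ∷ l) x ⊎ Blocked (below n) x
∈-below⇒skip⊎blocked n p with ∈-below⇒first⊎blocked n p
... | inj₁ (_ , refl , refl) = inj₁ (_ , here refl , skip)
... | inj₂ b                 = inj₂ b

moves-complete : ∀ S {x} → x ∈ remaining S → (∃ λ S′ → (x , S′) ∈ moves S) ⊎ Blocked (remaining S) x
moves-complete (E (suc n)) p with ∈-below⇒first⊎blocked (suc n) p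
... | inj₁ (_ , refl , refl) = inj₁ (_ , here refl)
... | inj₂ b                 = inj₂ b
moves-complete (A₁ zero)    (here refl)         = inj₁ (_ , here refl)
moves-complete (A₁ zero)    (there (here refl)) = inj₂ (_ , here refl , row refl)
moves-complete (A₁ (suc n)) (here refl)         = inj₁ (_ , here refl)
moves-complete (A₁ (suc n)) (there (here refl)) = inj₂ (_ , here refl , row refl)
moves-complete (A₁ (suc n)) (there (there p)) with ∈-below⇒first⊎blocked (suc n) p
... | inj₁ (_ , refl , refl) = inj₁ (_ , there (here refl))
... | inj₂ b                 = inj₂ (blocked-there (blocked-there b))
moves-complete (A₂ zero)    (here refl)         = inj₁ (_ , here refl)
moves-complete (A₂ (suc n)) (here refl)         = inj₁ (_ , here refl)
moves-complete (A₂ (suc n)) (there p) with ∈-below⇒first⊎blocked (suc n) p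
... | inj₁ (_ , refl , refl) = inj₁ (_ , there (here refl))
... | inj₂ b                 = inj₂ (blocked-there b)
moves-complete (P₁₁ n) (here refl)                         = inj₁ (_ , here refl)
moves-complete (P₁₁ n) (there (here refl))                 = inj₂ (_ , here refl , row refl)
moves-complete (P₁₁ n) (there (there (here refl)))         = inj₂ (_ , here refl , column)
moves-complete (P₁₁ n) (there (there (there (here refl)))) = inj₂ (_ , there (here refl) , column)
moves-complete (P₁₁ n) (there (there (there (there p)))) with ∈-below⇒skip⊎blocked n p
... | inj₁ b = inj₂ (blocked-there b)
... | inj₂ b = inj₂ (blocked-there (blocked-there (blocked-there (blocked-there b))))
moves-complete (P₂₁ n) (here refl)                 = inj₁ (_ , here refl)
moves-complete (P₂₁ n) (there (here refl))         = inj₁ (_ , there (here refl))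
moves-complete (P₂₁ n) (there (there (here refl))) = inj₂ (_ , here refl , column)
moves-complete (P₂₁ n) (there (there (there p))) with ∈-below⇒skip⊎blocked n p
... | inj₁ b = inj₂ b
... | inj₂ b = inj₂ (blocked-there (blocked-there (blocked-there b)))
moves-complete (P₂₂ n) (here refl)         = inj₁ (_ , here refl)
moves-complete (P₂₂ n) (there (here refl)) = inj₂ (_ , here refl , column)
moves-complete (P₂₂ n) (there (there p)) with ∈-below⇒skip⊎blocked n p
... | inj₁ b = inj₂ b
... | inj₂ b = inj₂ (blocked-there (blocked-there b))

run-↭ : ∀ {S w} → Run S w → w ↭ remaining S
run-↭ []            = refl
run-↭ (_∷_ {S} m r) = ↭-trans (prep _ (run-↭ r)) (↭-sym (moves-↭aining S m))

-- When `b` is written, an `a` not yet written would be a remaining cell, which `moves-minimal`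
-- forbids.
run-respects : ∀ {S w a b} → Run S w → a ∈ w → b ∈ w → Prec a b → Precedes a b w
run-respects r@(_∷_ {S} m _) a∈ (here refl) a<b =
  contradiction a<b (All.lookup (moves-minimal S m) (∈-resp-↭ (run-↭ r) a∈))
run-respects (m ∷ r) (here refl) (there b∈) a<b = here b∈
run-respects (m ∷ r) (there a∈)  (there b∈) a<b = there (run-respects r a∈ b∈ a<b)

precedes⇒∈ : ∀ {a b w} → Precedes a b w → b ∈ w
precedes⇒∈ (here b∈) = there b∈
precedes⇒∈ (there p) = there (precedes⇒∈ p)

precedes-tail : ∀ {a b x w} → x ≢ a → Precedes a b (x ∷ w) → Precedes a b w
precedes-tail x≢a (here _)  = contradiction refl x≢a
precedes-tail x≢a (there p) = p

-- If the state does not offer the head `x`, some remaining `a` has `Gen a x`. Then `a` precedes `x`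
-- in the word, so `x` occurs again in the tail, against uniqueness.
run-complete : ∀ S w → Unique w → w ↭ remaining S →
               (∀ {a b} → a ∈ w → b ∈ w → Gen a b → Precedes a b w) → Run S w
run-complete (E zero) [] _ _ _ = []
run-complete (E (suc n)) [] _ w↭ _ with () ← ↭-length w↭
run-complete (A₁ n)      [] _ w↭ _ with () ← ↭-length w↭
run-complete (A₂ n)      [] _ w↭ _ with () ← ↭-length w↭
run-complete (P₁₁ n)     [] _ w↭ _ with () ← ↭-length w↭
run-complete (P₂₁ n)     [] _ w↭ _ with () ← ↭-length w↭
run-complete (P₂₂ n)     [] _ w↭ _ with () ← ↭-length w↭
run-complete S (x ∷ w) (x∉w ∷ w!) w↭ respects
  with moves-complete S (∈-resp-↭ w↭ (here refl))
... | inj₁ (S′ , m) = m ∷ run-complete S′ w w! (drop-∷ (↭-trans w↭ (moves-↭aining S m)))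
  λ a∈ b∈ a<b → precedes-tail (All.lookup x∉w a∈) (respects (there a∈) (there b∈) a<b)
... | inj₂ (a , a∈ , a<x) = contradiction refl
  (All.lookup x∉w (x∈w (respects (∈-resp-↭ (↭-sym w↭) a∈) (here refl) a<x)))
  where
  x∈w : ∀ {a} → Precedes a x (x ∷ w) → x ∈ w
  x∈w (here p)  = p
  x∈w (there p) = precedes⇒∈ p

-- The length serves as fuel, since a move does not make the state structurally smaller. A path that
-- is not at `E 0` when the length is spent contributes no word.
runs : ℕ → State → List (List Cell)
runs zero    (E zero) = [] ∷ []
runs zero    _        = []
runs (suc k) S        = concat (map (λ (x , S′) → map (x ∷_) (runs k S′)) (moves S))

∈-runs⁻ : ∀ k S {w} → w ∈ runs k S → Run S w
∈-runs⁻ zero    (E zero) (here refl) = []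
∈-runs⁻ (suc k) S w∈
  with _ , w∈ws , ws∈ ← ∈-concat⁻′ (map (λ (x , S′) → map (x ∷_) (runs k S′)) (moves S)) w∈
  with (x , S′) , m , refl ← ∈-map⁻ (λ (x , S′) → map (x ∷_) (runs k S′)) ws∈
  with w′ , w′∈ , refl ← ∈-map⁻ (x ∷_) w∈ws = m ∷ ∈-runs⁻ k S′ w′∈

∈-runs⁺ : ∀ {S w} → Run S w → w ∈ runs (length w) S
∈-runs⁺ []      = here refl
∈-runs⁺ (m ∷ r) = ∈-concat⁺′ (∈-map⁺ _ (∈-runs⁺ r)) (∈-map⁺ _ m)

runs-unique : ∀ k S → Unique (runs k S)
runs-unique zero    (E zero)    = [] ∷ []
runs-unique zero    (E (suc n)) = []
runs-unique zero    (A₁ n)      = []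
runs-unique zero    (A₂ n)      = []
runs-unique zero    (P₁₁ n)     = []
runs-unique zero    (P₂₁ n)     = []
runs-unique zero    (P₂₂ n)     = []
runs-unique (suc k) S           = Unique.concat⁺
  (All.map⁺ (All.tabulate λ {(x , S′)} _ → Unique.map⁺ List.∷-injectiveʳ (runs-unique k S′)))
  (AllPairs.map⁺ (AllPairs.map disjoint (moves-distinct S)))
  where
  disjoint : ∀ {x y ws vs} → x ≢ y → Disjoint (map (x ∷_) ws) (map (y ∷_) vs)
  disjoint x≢y (p , q) with _ , _ , refl ← ∈-map⁻ _ p | _ , _ , eq ← ∈-map⁻ _ q =
    x≢y (List.∷-injectiveˡ eq)

-- Counting inversions along a run

value : Cell → ℕ
value (i , j) = 3 * i + toℕ j

-- Opaque, so that unification can read off x and w from smaller x w.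
opaque
  smaller : Cell → List Cell → ℕ
  smaller x w = length (filter (λ y → value y ℕ.<? value x) w)

inversions : List Cell → ℕ
inversions []      = 0
inversions (x ∷ w) = smaller x w + inversions w

value-row-< : ∀ {i i′} j j′ → i < i′ → value (i , j) < value (i′ , j′)
value-row-< {i} {i′} j j′ i<i′ = begin-strict
  3 * i + toℕ j   <⟨ ℕ.+-monoʳ-< (3 * i) (Fin.toℕ<n j) ⟩
  3 * i + 3       ≡⟨ ℕ.+-comm (3 * i) 3 ⟩
  3 + 3 * i       ≡⟨ ℕ.*-suc 3 i ⟨
  3 * suc i       ≤⟨ ℕ.*-monoʳ-≤ 3 i<i′ ⟩
  3 * i′          ≤⟨ ℕ.m≤m+n (3 * i′) (toℕ j′) ⟩
  3 * i′ + toℕ j′ ∎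
  where open ℕ.≤-Reasoning

opaque
  unfolding smaller

  -- The letters still to come matter only up to order, and `run-↭` fixes them from the state; hence
  -- a move has the same weight in all runs through it.
  smaller-↭ : ∀ x {w v} → w ↭ v → smaller x w ≡ smaller x v
  smaller-↭ x w↭v = ↭-length (filter-↭ (λ y → value y ℕ.<? value x) w↭v)

  smaller-lower : ∀ {i i′} j j′ l → i′ < i → smaller (i , j) ((i′ , j′) ∷ l) ≡ suc (smaller (i , j) l)
  smaller-lower j j′ l i′<i = cong length (List.filter-accept _ {xs = l} (value-row-< j′ j i′<i))

  smaller-right : ∀ i {j j′} l → j Fin.≤ j′ → smaller (i , j) ((i , j′) ∷ l) ≡ smaller (i , j) l
  smaller-right i l j≤j′ =
    cong length (List.filter-reject _ {xs = l} (ℕ.≤⇒≯ (ℕ.+-monoʳ-≤ (3 * i) j≤j′)))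

  smaller-upper : ∀ {i i′} j j′ l → i < i′ → smaller (i , j) ((i′ , j′) ∷ l) ≡ smaller (i , j) l
  smaller-upper j j′ l i<i′ = cong length (List.filter-reject _ {xs = l} (ℕ.<⇒≯ (value-row-< j j′ i<i′)))

  smaller-below : ∀ {n i} j → n ≤ i → smaller (i , j) (below n) ≡ 3 * n
  smaller-below {n} j n≤i = trans
    (cong length (List.filter-all _ (All.tabulate λ p → value-row-< _ j (ℕ.<-≤-trans (∈-below⇒< n p) n≤i))))
    (trans (length-below n) (ℕ.*-comm n 3))

-- Generating functions

coefficient-++ : ∀ f g e → coefficient (f ++ g) e ≡ coefficient f e ℤ.+ coefficient g e
coefficient-++ []            g e = sym (ℤ.+-identityˡ _)
coefficient-++ ((c , d) ∷ f) g e with ih ← coefficient-++ f g e | does (d ℤ.≟ e)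
... | true  = trans (cong (ℤ._+_ c) ih) (sym (ℤ.+-assoc c _ _))
... | false = ih

coefficient-↭ : ∀ {f g} → f ↭ g → f ≈ g
coefficient-↭ refl                     e = refl
coefficient-↭ (prep (c , d) p)         e with ih ← coefficient-↭ p e | does (d ℤ.≟ e)
... | true  = cong (ℤ._+_ c) ih
... | false = ih
coefficient-↭ (swap (c , d) (c′ , d′) p) e
  with ih ← coefficient-↭ p e | does (d ℤ.≟ e) | does (d′ ℤ.≟ e)
... | true  | true  = trans (cong (λ z → c ℤ.+ (c′ ℤ.+ z)) ih) (swap-+ c c′ _)
  where
  swap-+ : ∀ a b z → a ℤ.+ (b ℤ.+ z) ≡ b ℤ.+ (a ℤ.+ z)
  swap-+ = solve-∀
... | true  | false = cong (ℤ._+_ c) ih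
... | false | true  = cong (ℤ._+_ c′) ih
... | false | false = ih
coefficient-↭ (↭.trans p q)            e = trans (coefficient-↭ p e) (coefficient-↭ q e)

-- `coefficient` branches on the Boolean `does`, so the equivalence of the two tests is needed as an
-- equality of Booleans.
shift-≡ : ∀ a d e → does (a ℤ.+ d ℤ.≟ e) ≡ does (d ℤ.≟ e ℤ.- a)
shift-≡ a d e = does-⇔
  (mk⇔ (λ { refl → sym (to a d) }) (λ { refl → from a e })) (a ℤ.+ d ℤ.≟ e) (d ℤ.≟ e ℤ.- a)
  where
  to : ∀ a d → a ℤ.+ d ℤ.- a ≡ d
  to = solve-∀
  from : ∀ a e → a ℤ.+ (e ℤ.- a) ≡ e
  from = solve-∀

coefficient-shift : ∀ a f e → coefficient ((q^ a) *ᴸ f) e ≡ coefficient f (e ℤ.- a)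
coefficient-shift a []            e = refl
coefficient-shift a ((c , d) ∷ f) e
  rewrite shift-≡ a d e | ℤ.*-identityˡ c with ih ← coefficient-shift a f e | does (d ℤ.≟ e ℤ.- a)
... | true  = cong (ℤ._+_ c) ih
... | false = ih

-- Generating functions of the states

inv-terms : List (List Cell) → Laurent
inv-terms = map (λ w → 1ℤ , + inversions w)

inv-terms-∷ : ∀ x {c} ws → (∀ {w} → w ∈ ws → smaller x w ≡ c) →
              inv-terms (map (x ∷_) ws) ≡ (q^ (+ c)) *ᴸ inv-terms ws
inv-terms-∷ x []       _  = refl
inv-terms-∷ x (w ∷ ws) eq = cong₂ _∷_
  (cong (λ c → 1ℤ , + (c + inversions w)) (eq (here refl)))
  (inv-terms-∷ x ws (eq ∘ there))

-- The number of remaining cells, written so that it reduces to a successor and `runs (size S) S`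
-- unfolds by one move through computation.
size : State → ℕ
size (E n)   = n * 3
size (A₁ n)  = 2 + n * 3
size (A₂ n)  = 1 + n * 3
size (P₁₁ n) = 4 + n * 3
size (P₂₁ n) = 3 + n * 3
size (P₂₂ n) = 2 + n * 3

gf : State → ℤ → ℤ
gf S = coefficient (inv-terms (runs (size S) S))

gf-move : ∀ x S {c} d → smaller x (remaining S) ≡ c →
          coefficient (inv-terms (map (x ∷_) (runs (size S) S))) d ≡ gf S (d ℤ.- + c)
gf-move x S d refl = trans
  (cong (λ f → coefficient f d) (inv-terms-∷ x (runs (size S) S)
    λ w∈ → smaller-↭ x (run-↭ (∈-runs⁻ (size S) S w∈))))
  (coefficient-shift _ (inv-terms (runs (size S) S)) d)

-- The trailing `++ []` is left by `concat` after the last move, so that the left side is literally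
-- one unfolding of `runs`.
gf-one : ∀ x S {c} d → smaller x (remaining S) ≡ c →
         coefficient (inv-terms (map (x ∷_) (runs (size S) S) ++ [])) d ≡ gf S (d ℤ.- + c)
gf-one x S d eq = trans
  (cong (λ ws → coefficient (inv-terms ws) d) (List.++-identityʳ (map (x ∷_) (runs (size S) S))))
  (gf-move x S d eq)

gf-two : ∀ x S y T {c c′} k d → size S ≡ k → size T ≡ k →
         smaller x (remaining S) ≡ c → smaller y (remaining T) ≡ c′ →
         coefficient (inv-terms (map (x ∷_) (runs k S) ++ map (y ∷_) (runs k T) ++ [])) d
         ≡ gf S (d ℤ.- + c) ℤ.+ gf T (d ℤ.- + c′)
gf-two x S y T k d refl kT eq eq′ = trans
  (cong (λ f → coefficient f d) (List.map-++ _ (map (x ∷_) (runs k S)) _))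
  (trans (coefficient-++ (inv-terms (map (x ∷_) (runs k S))) _ d)
    (cong₂ ℤ._+_ (gf-move x S d eq)
      (trans (cong (λ k → coefficient (inv-terms (map (y ∷_) (runs k T) ++ [])) d) (sym kT))
        (gf-one y T d eq′))))

-- In this and the following equations the weight counts the cells left in lower rows: three for
-- each untouched row, plus what is left of row `n` when a `P` state writes into row `suc n`.
gf-E : ∀ n d → gf (E (suc n)) d ≡ gf (A₁ n) (d ℤ.- + (3 * n))
gf-E n d = gf-one (n , 0F) (A₁ n) d
  (trans (smaller-right n _ z≤n) (trans (smaller-right n _ z≤n) (smaller-below 0F ℕ.≤-refl)))

gf-A₁ : ∀ n d → gf (A₁ (suc n)) d ≡ gf (A₂ (suc n)) (d ℤ.- + (3 * suc n)) ℤ.+ gf (P₁₁ n) (d ℤ.- + (3 * n))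
gf-A₁ n d = gf-two (suc n , 1F) (A₂ (suc n)) (n , 0F) (P₁₁ n) (4 + n * 3) d refl refl
  (trans (smaller-right (suc n) _ (s≤s z≤n)) (smaller-below 1F ℕ.≤-refl))
  (trans (smaller-upper 0F 1F _ ℕ.≤-refl) (trans (smaller-upper 0F 2F _ ℕ.≤-refl)
    (trans (smaller-right n _ z≤n) (trans (smaller-right n _ z≤n) (smaller-below 0F ℕ.≤-refl)))))

gf-A₂ : ∀ n d → gf (A₂ (suc n)) d ≡ gf (E (suc n)) (d ℤ.- + (3 * suc n)) ℤ.+ gf (P₂₁ n) (d ℤ.- + (3 * n))
gf-A₂ n d = gf-two (suc n , 2F) (E (suc n)) (n , 0F) (P₂₁ n) (3 + n * 3) d refl refl
  (smaller-below 2F ℕ.≤-refl)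
  (trans (smaller-upper 0F 2F _ ℕ.≤-refl)
    (trans (smaller-right n _ z≤n) (trans (smaller-right n _ z≤n) (smaller-below 0F ℕ.≤-refl))))

gf-P₁₁ : ∀ n d → gf (P₁₁ n) d ≡ gf (P₂₁ n) (d ℤ.- + (2 + 3 * n))
gf-P₁₁ n d = gf-one (suc n , 1F) (P₂₁ n) d
  (trans (smaller-right (suc n) _ (s≤s z≤n)) (trans (smaller-lower 1F 1F _ ℕ.≤-refl)
    (cong suc (trans (smaller-lower 1F 2F _ ℕ.≤-refl) (cong suc (smaller-below 1F (ℕ.n≤1+n n)))))))

gf-P₂₁ : ∀ n d → gf (P₂₁ n) d ≡ gf (A₁ n) (d ℤ.- + (2 + 3 * n)) ℤ.+ gf (P₂₂ n) (d ℤ.- + (3 * n))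
gf-P₂₁ n d = gf-two (suc n , 2F) (A₁ n) (n , 1F) (P₂₂ n) (2 + n * 3) d refl refl
  (trans (smaller-lower 2F 1F _ ℕ.≤-refl)
    (cong suc (trans (smaller-lower 2F 2F _ ℕ.≤-refl) (cong suc (smaller-below 2F (ℕ.n≤1+n n))))))
  (trans (smaller-upper 1F 2F _ ℕ.≤-refl) (trans (smaller-right n _ (s≤s z≤n)) (smaller-below 1F ℕ.≤-refl)))

gf-P₂₂ : ∀ n d → gf (P₂₂ n) d ≡ gf (A₂ n) (d ℤ.- + (1 + 3 * n))
gf-P₂₂ n d = gf-one (suc n , 2F) (A₂ n) d
  (trans (smaller-lower 2F 2F _ ℕ.≤-refl) (cong suc (smaller-below 2F (ℕ.n≤1+n n))))

δ : ℤ → ℤ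
δ = coefficient (constant 1ℤ)

gf-A₂-zero : ∀ d → gf (A₂ 0) d ≡ δ d
gf-A₂-zero d = trans (gf-one (0 , 2F) (E 0) d (smaller-below 2F z≤n)) (cong δ (ℤ.+-identityʳ d))

gf-A₁-zero : ∀ d → gf (A₁ 0) d ≡ δ d
gf-A₁-zero d = trans
  (gf-one (0 , 1F) (A₂ 0) d (trans (smaller-right 0 [] (s≤s z≤n)) (smaller-below 1F z≤n)))
  (trans (gf-A₂-zero (d ℤ.- 0ℤ)) (cong δ (ℤ.+-identityʳ d)))

-- With r = 1/q, so that r shifts coefficients by one, gf (A₁ m) and gf (A₂ m)
-- are q^(h m + 3m) f m and q^(h m) g m.  The pair (f , g) evolves by the matrix
-- ((1+r+r², r²+r³), (1+r, r²)), of trace 1+r+2r² and determinant -r³.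
f g : ℕ → ℤ → ℤ
f zero    d = δ d
f (suc m) d = g (suc m) d ℤ.+ (f m (d ℤ.+ + 2) ℤ.+ g m (d ℤ.+ + 3))
g zero    d = δ d
g (suc m) d = f m d ℤ.+ (f m (d ℤ.+ + 1) ℤ.+ g m (d ℤ.+ + 2))

-- The increment is `3(m+1) + 3m + 3m`, the weights along `A₂ (suc m)`, `E (suc m)`, `A₁ m`, `A₂ m`.
-- So `h m` counts the inversions of the run from `A₂ m` without overlapping rows; in closed form it
-- is `9 C(m,2) + 3m`.
h : ℕ → ℤ
h zero    = 0ℤ
h (suc m) = h m ℤ.+ (+ 9 ℤ.* + m ℤ.+ + 3)

cast : ∀ k m → + (k + 3 * m) ≡ + k ℤ.+ + 3 ℤ.* + m
cast k m = trans (ℤ.pos-+ k (3 * m)) (cong (ℤ._+_ (+ k)) (ℤ.pos-* 3 m))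

cast-suc : ∀ m → + (3 * suc m) ≡ + 3 ℤ.+ + 3 ℤ.* + m
cast-suc m = trans (cong +_ (ℕ.*-suc 3 m)) (cast 3 m)

-- A mutual induction along the moves. `P₁₁` and `P₂₂` have one move each and are substituted away,
-- so among the `P` states only `P₂₁` needs a formula of its own.
gf-A₁≡f : ∀ m d → gf (A₁ m) (h m ℤ.+ + 3 ℤ.* + m ℤ.+ d) ≡ f m d
gf-A₂≡g : ∀ m d → gf (A₂ m) (h m ℤ.+ d) ≡ g m d
gf-P₂₁≡ : ∀ m d → gf (P₂₁ m) (h m ℤ.+ + 6 ℤ.* + m ℤ.+ d) ≡ f m (d ℤ.- + 2) ℤ.+ g m (d ℤ.- + 1)

gf-P₂₁≡ m d = begin
  gf (P₂₁ m) D ≡⟨ gf-P₂₁ m D ⟩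
  gf (A₁ m) (D ℤ.- + (2 + 3 * m)) ℤ.+ gf (P₂₂ m) (D ℤ.- + (3 * m))
    ≡⟨ cong₂ (λ a b → gf (A₁ m) (D ℤ.- a) ℤ.+ b) (cast 2 m) (gf-P₂₂ m _) ⟩
  gf (A₁ m) (D ℤ.- (+ 2 ℤ.+ + 3 ℤ.* + m)) ℤ.+ gf (A₂ m) (D ℤ.- + (3 * m) ℤ.- + (1 + 3 * m))
    ≡⟨ cong₂ (λ a b → gf (A₁ m) a ℤ.+ gf (A₂ m) b) (arith₁ (h m) (+ m) d)
         (trans (cong₂ (λ a b → D ℤ.- a ℤ.- b) (cast 0 m) (cast 1 m)) (arith₂ (h m) (+ m) d)) ⟩
  gf (A₁ m) (h m ℤ.+ + 3 ℤ.* + m ℤ.+ (d ℤ.- + 2)) ℤ.+ gf (A₂ m) (h m ℤ.+ (d ℤ.- + 1))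
    ≡⟨ cong₂ ℤ._+_ (gf-A₁≡f m _) (gf-A₂≡g m _) ⟩
  f m (d ℤ.- + 2) ℤ.+ g m (d ℤ.- + 1) ∎
  where
  open ≡-Reasoning
  D = h m ℤ.+ + 6 ℤ.* + m ℤ.+ d
  arith₁ : ∀ h m d → h ℤ.+ + 6 ℤ.* m ℤ.+ d ℤ.- (+ 2 ℤ.+ + 3 ℤ.* m) ≡ h ℤ.+ + 3 ℤ.* m ℤ.+ (d ℤ.- + 2)
  arith₁ = solve-∀
  -- The summand `+ 0` is the form in which `cast 0 m` delivers `+ (3 * m)`.
  arith₂ : ∀ h m d → h ℤ.+ + 6 ℤ.* m ℤ.+ d ℤ.- (+ 0 ℤ.+ + 3 ℤ.* m) ℤ.- (+ 1 ℤ.+ + 3 ℤ.* m) ≡ h ℤ.+ (d ℤ.- + 1)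
  arith₂ = solve-∀

gf-A₁≡f zero    d = trans (gf-A₁-zero (0ℤ ℤ.+ d)) (cong δ (ℤ.+-identityˡ d))
gf-A₁≡f (suc m) d = begin
  gf (A₁ (suc m)) D ≡⟨ gf-A₁ m D ⟩
  gf (A₂ (suc m)) (D ℤ.- + (3 * suc m)) ℤ.+ gf (P₁₁ m) (D ℤ.- + (3 * m))
    ≡⟨ cong₂ (λ a b → gf (A₂ (suc m)) a ℤ.+ b)
         (trans (cong (ℤ._-_ D) (ℤ.pos-* 3 (suc m))) (arith₁ (h (suc m)) (+ suc m) d)) (gf-P₁₁ m _) ⟩
  gf (A₂ (suc m)) (h (suc m) ℤ.+ d) ℤ.+ gf (P₂₁ m) (D ℤ.- + (3 * m) ℤ.- + (2 + 3 * m))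
    ≡⟨ cong₂ (λ a b → a ℤ.+ gf (P₂₁ m) b) (gf-A₂≡g (suc m) d)
         (trans (cong₂ (λ a b → D ℤ.- a ℤ.- b) (cast 0 m) (cast 2 m))
           (arith₂ (h m) (+ m) d)) ⟩
  g (suc m) d ℤ.+ gf (P₂₁ m) (h m ℤ.+ + 6 ℤ.* + m ℤ.+ (d ℤ.+ + 4))
    ≡⟨ cong (ℤ._+_ (g (suc m) d)) (gf-P₂₁≡ m (d ℤ.+ + 4)) ⟩
  g (suc m) d ℤ.+ (f m (d ℤ.+ + 4 ℤ.- + 2) ℤ.+ g m (d ℤ.+ + 4 ℤ.- + 1))
    ≡⟨ cong₂ (λ a b → g (suc m) d ℤ.+ (f m a ℤ.+ g m b)) (ℤ.+-assoc d (+ 4) _) (ℤ.+-assoc d (+ 4) _) ⟩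
  f (suc m) d ∎
  where
  open ≡-Reasoning
  D = h (suc m) ℤ.+ + 3 ℤ.* + suc m ℤ.+ d
  arith₁ : ∀ h n d → h ℤ.+ + 3 ℤ.* n ℤ.+ d ℤ.- + 3 ℤ.* n ≡ h ℤ.+ d
  arith₁ = solve-∀
  arith₂ : ∀ h m d → h ℤ.+ (+ 9 ℤ.* m ℤ.+ + 3) ℤ.+ + 3 ℤ.* (+ 1 ℤ.+ m) ℤ.+ d
                     ℤ.- (+ 0 ℤ.+ + 3 ℤ.* m) ℤ.- (+ 2 ℤ.+ + 3 ℤ.* m)
                     ≡ h ℤ.+ + 6 ℤ.* m ℤ.+ (d ℤ.+ + 4)
  arith₂ = solve-∀

gf-A₂≡g zero    d = trans (gf-A₂-zero (0ℤ ℤ.+ d)) (cong δ (ℤ.+-identityˡ d))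
gf-A₂≡g (suc m) d = begin
  gf (A₂ (suc m)) D ≡⟨ gf-A₂ m D ⟩
  gf (E (suc m)) (D ℤ.- + (3 * suc m)) ℤ.+ gf (P₂₁ m) (D ℤ.- + (3 * m))
    ≡⟨ cong (ℤ._+ gf (P₂₁ m) (D ℤ.- + (3 * m))) (gf-E m (D ℤ.- + (3 * suc m))) ⟩
  gf (A₁ m) (D ℤ.- + (3 * suc m) ℤ.- + (3 * m)) ℤ.+ gf (P₂₁ m) (D ℤ.- + (3 * m))
    ≡⟨ cong₂ (λ a b → gf (A₁ m) a ℤ.+ gf (P₂₁ m) b)
         (trans (cong₂ (λ a b → D ℤ.- a ℤ.- b) (cast-suc m) (cast 0 m)) (arith₁ (h m) (+ m) d))
         (trans (cong (ℤ._-_ D) (cast 0 m)) (arith₂ (h m) (+ m) d)) ⟩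
  gf (A₁ m) (h m ℤ.+ + 3 ℤ.* + m ℤ.+ d) ℤ.+ gf (P₂₁ m) (h m ℤ.+ + 6 ℤ.* + m ℤ.+ (d ℤ.+ + 3))
    ≡⟨ cong₂ ℤ._+_ (gf-A₁≡f m d) (gf-P₂₁≡ m (d ℤ.+ + 3)) ⟩
  f m d ℤ.+ (f m (d ℤ.+ + 3 ℤ.- + 2) ℤ.+ g m (d ℤ.+ + 3 ℤ.- + 1))
    ≡⟨ cong₂ (λ a b → f m d ℤ.+ (f m a ℤ.+ g m b)) (ℤ.+-assoc d (+ 3) _) (ℤ.+-assoc d (+ 3) _) ⟩
  g (suc m) d ∎
  where
  open ≡-Reasoning
  D = h (suc m) ℤ.+ d
  arith₁ : ∀ h m d → h ℤ.+ (+ 9 ℤ.* m ℤ.+ + 3) ℤ.+ d ℤ.- (+ 3 ℤ.+ + 3 ℤ.* m) ℤ.- (+ 0 ℤ.+ + 3 ℤ.* m)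
                     ≡ h ℤ.+ + 3 ℤ.* m ℤ.+ d
  arith₁ = solve-∀
  arith₂ : ∀ h m d → h ℤ.+ (+ 9 ℤ.* m ℤ.+ + 3) ℤ.+ d ℤ.- (+ 0 ℤ.+ + 3 ℤ.* m)
                     ≡ h ℤ.+ + 6 ℤ.* m ℤ.+ (d ℤ.+ + 3)
  arith₂ = solve-∀

-- Cayley-Hamilton for the matrix of `(f , g)`, checked by unfolding. The values of `f (suc m)` at
-- `d` and `d + 1` stay folded, since they occur unchanged on both sides.
f-recurrence : ∀ m d → f (suc (suc m)) d ≡
  f (suc m) d ℤ.+ f (suc m) (d ℤ.+ + 1) ℤ.+ + 2 ℤ.* f (suc m) (d ℤ.+ + 2) ℤ.+ f m (d ℤ.+ + 3)
f-recurrence m d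
  -- Stacked shifts of `d` are merged; the sums of literals then compute.
  rewrite ℤ.+-assoc d (+ 2) (+ 1) | ℤ.+-assoc d (+ 2) (+ 2) | ℤ.+-assoc d (+ 2) (+ 3)
        | ℤ.+-assoc d (+ 3) (+ 1) | ℤ.+-assoc d (+ 3) (+ 2) =
  algebra (f (suc m) d) (f (suc m) (d ℤ.+ + 1)) (f m (d ℤ.+ + 2)) (f m (d ℤ.+ + 3))
    (f m (d ℤ.+ + 4)) (g m (d ℤ.+ + 4)) (g m (d ℤ.+ + 5))
  where
  algebra : ∀ a b p q r s t →
    a ℤ.+ (b ℤ.+ (p ℤ.+ (q ℤ.+ s))) ℤ.+ (p ℤ.+ (q ℤ.+ s) ℤ.+ (r ℤ.+ t) ℤ.+ (q ℤ.+ (r ℤ.+ t)))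
    ≡ a ℤ.+ b ℤ.+ + 2 ℤ.* (p ℤ.+ (q ℤ.+ s) ℤ.+ (r ℤ.+ t)) ℤ.+ q
  algebra = solve-∀

-- Evaluation of polynomials at `r = 1/q`

ev : Polynomial → ℤ → ℤ
ev P = coefficient (evaluate P (q^ -1ℤ))

coefficient-constant : ∀ a d → coefficient (constant a) d ≡ a ℤ.* δ d
coefficient-constant a d with does (0ℤ ℤ.≟ d)
... | true  = trans (ℤ.+-identityʳ a) (sym (ℤ.*-identityʳ a))
... | false = sym (ℤ.*-zeroʳ a)

-- Multiplication by `1/q` moves the coefficient at `d + 1` to `d`; this shift plays the part of `r`
-- in every coefficientwise recurrence.
ev-∷ : ∀ a P d → ev (a ∷ P) d ≡ a ℤ.* δ d ℤ.+ ev P (d ℤ.+ + 1)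
ev-∷ a P d = trans (coefficient-++ (constant a) ((q^ -1ℤ) *ᴸ evaluate P (q^ -1ℤ)) d)
  (cong₂ ℤ._+_ (coefficient-constant a d) (coefficient-shift -1ℤ (evaluate P (q^ -1ℤ)) d))

ev-+ : ∀ P Q d → ev (P +ᴾ Q) d ≡ ev P d ℤ.+ ev Q d
ev-+ []      Q       d = sym (ℤ.+-identityˡ _)
ev-+ (a ∷ P) []      d = sym (ℤ.+-identityʳ _)
ev-+ (a ∷ P) (b ∷ Q) d rewrite ev-∷ (a ℤ.+ b) (P +ᴾ Q) d | ev-∷ a P d | ev-∷ b Q d | ev-+ P Q (d ℤ.+ + 1) =
  algebra a b (δ d) (ev P (d ℤ.+ + 1)) (ev Q (d ℤ.+ + 1))
  where
  algebra : ∀ a b z p q → (a ℤ.+ b) ℤ.* z ℤ.+ (p ℤ.+ q) ≡ a ℤ.* z ℤ.+ p ℤ.+ (b ℤ.* z ℤ.+ q)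
  algebra = solve-∀

ev-scale : ∀ a P d → ev (map (a ℤ.*_) P) d ≡ a ℤ.* ev P d
ev-scale a []      d = sym (ℤ.*-zeroʳ a)
ev-scale a (b ∷ P) d rewrite ev-∷ (a ℤ.* b) (map (a ℤ.*_) P) d | ev-∷ b P d | ev-scale a P (d ℤ.+ + 1) =
  algebra a b (δ d) (ev P (d ℤ.+ + 1))
  where
  algebra : ∀ a b z p → a ℤ.* b ℤ.* z ℤ.+ a ℤ.* p ≡ a ℤ.* (b ℤ.* z ℤ.+ p)
  algebra = solve-∀

ev-* : ∀ a P Q d → ev ((a ∷ P) *ᴾ Q) d ≡ a ℤ.* ev Q d ℤ.+ ev (P *ᴾ Q) (d ℤ.+ + 1)
ev-* a P Q d rewrite ev-+ (map (a ℤ.*_) Q) (0ℤ ∷ P *ᴾ Q) d | ev-scale a Q d | ev-∷ 0ℤ (P *ᴾ Q) d =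
  cong (ℤ._+_ (a ℤ.* ev Q d)) (ℤ.+-identityˡ _)

ev-F : ∀ s d → ev (F (suc (suc s))) d ≡
  ev (F (suc s)) d ℤ.+ ev (F (suc s)) (d ℤ.+ + 1) ℤ.+ + 2 ℤ.* ev (F (suc s)) (d ℤ.+ + 2)
  ℤ.+ ev (F s) (d ℤ.+ + 3)
ev-F s d
  rewrite ev-+ ((+ 1 ∷ + 1 ∷ + 2 ∷ []) *ᴾ F (suc s)) ((+ 0 ∷ + 0 ∷ + 0 ∷ + 1 ∷ []) *ᴾ F s) d
        | ev-* (+ 1) (+ 1 ∷ + 2 ∷ []) (F (suc s)) d
        | ev-* (+ 1) (+ 2 ∷ []) (F (suc s)) (d ℤ.+ + 1)
        | ev-* (+ 2) [] (F (suc s)) (d ℤ.+ + 1 ℤ.+ + 1)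
        | ev-* (+ 0) (+ 0 ∷ + 0 ∷ + 1 ∷ []) (F s) d
        | ev-* (+ 0) (+ 0 ∷ + 1 ∷ []) (F s) (d ℤ.+ + 1)
        | ev-* (+ 0) (+ 1 ∷ []) (F s) (d ℤ.+ + 1 ℤ.+ + 1)
        | ev-* (+ 1) [] (F s) (d ℤ.+ + 1 ℤ.+ + 1 ℤ.+ + 1)
        | ℤ.+-assoc d (+ 1) (+ 1) | ℤ.+-assoc d (+ 2) (+ 1) =
  algebra (ev (F (suc s)) d) (ev (F (suc s)) (d ℤ.+ + 1)) (ev (F (suc s)) (d ℤ.+ + 2))
    (ev (F s) d) (ev (F s) (d ℤ.+ + 1)) (ev (F s) (d ℤ.+ + 2)) (ev (F s) (d ℤ.+ + 3))
  where
  algebra : ∀ a b c p q r t →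
    + 1 ℤ.* a ℤ.+ (+ 1 ℤ.* b ℤ.+ (+ 2 ℤ.* c ℤ.+ 0ℤ)) ℤ.+
    (+ 0 ℤ.* p ℤ.+ (+ 0 ℤ.* q ℤ.+ (+ 0 ℤ.* r ℤ.+ (+ 1 ℤ.* t ℤ.+ 0ℤ))))
    ≡ a ℤ.+ b ℤ.+ + 2 ℤ.* c ℤ.+ t
  algebra = solve-∀

-- The index shifts by one because a run from `E (suc m)` must first pass to `A₁ m`. A recurrence of
-- order two needs two base cases, and the second one rests on `F 0 = 1`.
f≡ev-F : ∀ m d → f m d ≡ ev (F (suc m)) d
f≡ev-F zero          d = refl
f≡ev-F (suc zero)    d = trans
  (algebra (δ d) (δ (d ℤ.+ + 1)) (δ (d ℤ.+ + 2)) (δ (d ℤ.+ + 3))) (sym (ev-F 0 d))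
  where
  algebra : ∀ a b c t → a ℤ.+ (b ℤ.+ c) ℤ.+ (c ℤ.+ t) ≡ a ℤ.+ b ℤ.+ + 2 ℤ.* c ℤ.+ t
  algebra = solve-∀
f≡ev-F (suc (suc m)) d = trans (f-recurrence m d) (trans
  (cong₂ ℤ._+_
    (cong₂ ℤ._+_ (cong₂ ℤ._+_ (f≡ev-F (suc m) d) (f≡ev-F (suc m) (d ℤ.+ + 1)))
                 (cong (+ 2 ℤ.*_) (f≡ev-F (suc m) (d ℤ.+ + 2))))
    (f≡ev-F m (d ℤ.+ + 3)))
  (sym (ev-F (suc m) d)))

-- The right side is the weight `3m` of the forced first letter plus the offset `h m + 3m` of
-- `A₁ m`. In the inductive step Pascal's rule adds `9(m+1)`, which is `(9m+3) + 6`.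
exponent : ∀ m → + (9 * (suc m C 2)) ≡ h m ℤ.+ + 6 ℤ.* + m
exponent zero    = refl
exponent (suc m) = begin
  + (9 * (suc (suc m) C 2))                     ≡⟨ cong (λ c → + (9 * c)) (nCk+nC[k+1]≡[n+1]C[k+1] (suc m) 1) ⟨
  + (9 * ((suc m C 1) + (suc m C 2)))           ≡⟨ cong (λ c → + (9 * (c + (suc m C 2)))) (nC1≡n (suc m)) ⟩
  + (9 * (suc m + (suc m C 2)))                 ≡⟨ cong +_ (ℕ.*-distribˡ-+ 9 (suc m) (suc m C 2)) ⟩
  + (9 * suc m + 9 * (suc m C 2))               ≡⟨ ℤ.pos-+ (9 * suc m) _ ⟩
  + (9 * suc m) ℤ.+ + (9 * (suc m C 2))         ≡⟨ cong₂ ℤ._+_ (ℤ.pos-* 9 (suc m)) (exponent m) ⟩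
  + 9 ℤ.* + suc m ℤ.+ (h m ℤ.+ + 6 ℤ.* + m)     ≡⟨ algebra (h m) (+ m) ⟩
  h (suc m) ℤ.+ + 6 ℤ.* + suc m                 ∎
  where
  open ≡-Reasoning
  algebra : ∀ h m → + 9 ℤ.* (+ 1 ℤ.+ m) ℤ.+ (h ℤ.+ + 6 ℤ.* m) ≡ h ℤ.+ (+ 9 ℤ.* m ℤ.+ + 3) ℤ.+ + 6 ℤ.* (+ 1 ℤ.+ m)
  algebra = solve-∀

gf-E≡ : ∀ m →
  inv-terms (runs (suc m * 3) (E (suc m))) ≈ (q^ (+ (9 * (suc m C 2)))) *ᴸ evaluate (F (suc m)) (q^ -1ℤ)
gf-E≡ m d = begin
  gf (E (suc m)) d                      ≡⟨ gf-E m d ⟩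
  gf (A₁ m) (d ℤ.- + (3 * m))           
    ≡⟨ cong (gf (A₁ m)) (trans (cong (ℤ._-_ d) (cast 0 m)) (algebra (h m) (+ m) d)) ⟩
  gf (A₁ m) (h m ℤ.+ + 3 ℤ.* + m ℤ.+ (d ℤ.- (h m ℤ.+ + 6 ℤ.* + m))) ≡⟨ gf-A₁≡f m _ ⟩
  f m (d ℤ.- (h m ℤ.+ + 6 ℤ.* + m))     ≡⟨ f≡ev-F m _ ⟩
  ev (F (suc m)) (d ℤ.- (h m ℤ.+ + 6 ℤ.* + m)) ≡⟨ cong (λ a → ev (F (suc m)) (d ℤ.- a)) (exponent m) ⟨
  ev (F (suc m)) (d ℤ.- + (9 * (suc m C 2)))
    ≡⟨ coefficient-shift (+ (9 * (suc m C 2))) (evaluate (F (suc m)) (q^ -1ℤ)) d ⟨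
  coefficient ((q^ (+ (9 * (suc m C 2)))) *ᴸ evaluate (F (suc m)) (q^ -1ℤ)) d ∎
  where
  open ≡-Reasoning
  algebra : ∀ h m d → d ℤ.- (+ 0 ℤ.+ + 3 ℤ.* m) ≡ h ℤ.+ + 3 ℤ.* m ℤ.+ (d ℤ.- (h ℤ.+ + 6 ℤ.* m))
  algebra = solve-∀

-- Words and their lists of cells

cell : ∀ {s} → Fin (s * 3) → Cell
cell {s} x = let i , j = remQuot {s} 3 x in toℕ i , j

cell-combine : ∀ {s} (i : Fin s) j → cell {s} (combine i j) ≡ (toℕ i , j)
cell-combine i j = cong (λ (i , j) → toℕ i , j) (Fin.remQuot-combine i j)

value-cell : ∀ {s} (x : Fin (s * 3)) → value (cell {s} x) ≡ toℕ x
value-cell {s} x = trans (sym (Fin.toℕ-combine (proj₁ (remQuot {s} 3 x)) _))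
  (cong toℕ (Fin.combine-remQuot {s} 3 x))

cell-injective : ∀ {s} {x y : Fin (s * 3)} → cell {s} x ≡ cell {s} y → x ≡ y
cell-injective {s} {x} {y} eq =
  Fin.toℕ-injective (trans (sym (value-cell {s} x)) (trans (cong value eq) (value-cell {s} y)))

cell-surjective : ∀ {s i} j → i < s → ∃ λ (x : Fin (s * 3)) → cell {s} x ≡ (i , j)
cell-surjective j i<s =
  combine (fromℕ< i<s) j , trans (cell-combine (fromℕ< i<s) j) (cong (_, j) (Fin.toℕ-fromℕ< i<s))

cell-row< : ∀ {s} (x : Fin (s * 3)) → proj₁ (cell {s} x) < s
cell-row< {s} x = Fin.toℕ<n (proj₁ (remQuot {s} 3 x))

value-<⇒ : ∀ {i j i′ j′} → value (i , j) < value (i′ , j′) → i < i′ ⊎ (i ≡ i′ × j Fin.< j′)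
value-<⇒ {i} {j} {i′} {j′} lt with ℕ.<-cmp i i′
... | tri< i<i′ _ _ = inj₁ i<i′
... | tri≈ _ refl _ = inj₂ (refl , ℕ.+-cancelˡ-< (3 * i) _ _ lt)
... | tri> _ _ i′<i = contradiction lt (ℕ.<-asym (value-row-< j′ j i′<i))

cells : ∀ {s m} → Word m (s * 3) → List Cell
cells {s} v = tabulate (cell {s} ∘ lookup v)

lookup-extensional : ∀ {A : Set} {m} (v w : Vec A m) → lookup v ≗ lookup w → v ≡ w
lookup-extensional v w eq =
  trans (sym (Vec.tabulate∘lookup v)) (trans (Vec.tabulate-cong eq) (Vec.tabulate∘lookup w))

tabulate-injective : ∀ {A : Set} {m} {f g : Fin m → A} → tabulate f ≡ tabulate g → f ≗ g
tabulate-injective eq Fin.zero    = List.∷-injectiveˡ eq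
tabulate-injective eq (Fin.suc i) = tabulate-injective (List.∷-injectiveʳ eq) i

cells-injective : ∀ {s m} {v w : Word m (s * 3)} → cells {s} v ≡ cells {s} w → v ≡ w
cells-injective {s} {v = v} {w} eq = lookup-extensional v w (cell-injective {s} ∘ tabulate-injective eq)

cells-surjective : ∀ {s m} l → length l ≡ m → All (λ c → proj₁ c < s) l →
                   ∃ λ (v : Word m (s * 3)) → cells {s} v ≡ l
cells-surjective []      refl []       = [] , refl
cells-surjective {s} (c ∷ l) refl (c< ∷ l<) =
  let x , x≡c = cell-surjective {s} (proj₂ c) c<
      v , v≡l = cells-surjective {s} l refl l<
  in x ∷ v , cong₂ _∷_ x≡c v≡l

unique-tabulate⇒injective : ∀ {A : Set} {m} {f : Fin m → A} → Unique (tabulate f) →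
                            ∀ {i j} → f i ≡ f j → i ≡ j
unique-tabulate⇒injective (_ ∷ _)  {Fin.zero}  {Fin.zero}  _  = refl
unique-tabulate⇒injective (x∉ ∷ _) {Fin.zero}  {Fin.suc j} eq = contradiction eq (All.tabulate⁻ x∉ j)
unique-tabulate⇒injective (x∉ ∷ _) {Fin.suc i} {Fin.zero}  eq = contradiction (sym eq) (All.tabulate⁻ x∉ i)
unique-tabulate⇒injective (_ ∷ !)  {Fin.suc i} {Fin.suc j} eq = cong Fin.suc (unique-tabulate⇒injective ! eq)

tabulate-precedes⁺ : ∀ {m} (f : Fin m → Cell) {i j} → i Fin.< j → Precedes (f i) (f j) (tabulate f)
tabulate-precedes⁺ f {Fin.zero}  {Fin.suc j} _         = here (∈-tabulate⁺ j)
tabulate-precedes⁺ f {Fin.suc i} {Fin.suc j} (s≤s i<j) = there (tabulate-precedes⁺ (f ∘ Fin.suc) i<j)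

tabulate-precedes⁻ : ∀ {m a b} (f : Fin m → Cell) → Precedes a b (tabulate f) →
                     ∃₂ λ i j → i Fin.< j × f i ≡ a × f j ≡ b
tabulate-precedes⁻ {suc m} f (here b∈) with j , refl ← ∈-tabulate⁻ b∈ =
  Fin.zero , Fin.suc j , z<s , refl , refl
tabulate-precedes⁻ {suc m} f (there p) with i , j , i<j , eqs ← tabulate-precedes⁻ (f ∘ Fin.suc) p =
  Fin.suc i , Fin.suc j , s<s i<j , eqs

before⇒precedes : ∀ {s m} {v : Word m (s * 3)} {a b} → Before v a b →
                  Precedes (cell {s} a) (cell {s} b) (cells {s} v)
before⇒precedes {s} {v = v} (_ , _ , i<j , refl , refl) = tabulate-precedes⁺ (cell {s} ∘ lookup v) i<j

precedes⇒before : ∀ {s m} {v : Word m (s * 3)} {a b} → Precedes (cell {s} a) (cell {s} b) (cells {s} v) →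
                  Before v a b
precedes⇒before {s} {v = v} p with i , j , i<j , eq , eq′ ← tabulate-precedes⁻ (cell {s} ∘ lookup v) p =
  i , j , i<j , cell-injective {s} eq , cell-injective {s} eq′

-- Inversions of words and of lists of cells

length-filter-map : ∀ {A B : Set} {P : B → Set} (P? : Decidable P) (f : A → B) l →
                    length (filter P? (map f l)) ≡ length (filter (P? ∘ f) l)
length-filter-map P? f []      = refl
length-filter-map P? f (x ∷ l) with ih ← length-filter-map P? f l | does (P? (f x))
... | true  = cong suc ih
... | false = ih

length-filter-++ : ∀ {A : Set} {P : A → Set} (P? : Decidable P) l l′ →
                   length (filter P? (l ++ l′)) ≡ length (filter P? l) + length (filter P? l′)
length-filter-++ P? l l′ = trans (cong length (List.filter-++ P? l l′)) (List.length-++ (filter P? l))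

-- Length and alphabet vary independently, unlike in `inv`, because the induction drops a letter of
-- the word but keeps the alphabet.
Inversion : ∀ {m n} → Word m n → Fin m × Fin m → Set
Inversion v (i , j) = i Fin.< j × lookup v j Fin.< lookup v i

inv? : ∀ {m n} (v : Word m n) → Decidable (Inversion v)
inv? v (i , j) = (i Fin.<? j) ×-dec (lookup v j Fin.<? lookup v i)

-- Two lists are used because the induction consumes `l` while `l′` must stay whole. The pairs with
-- second position `Fin.zero` vanish by computation.
inv-tail : ∀ {m n} x (v : Word m n) l l′ →
  length (filter (inv? (x ∷ v)) (cartesianProduct (map Fin.suc l) (Fin.zero ∷ map Fin.suc l′)))
  ≡ length (filter (inv? v) (cartesianProduct l l′))
inv-tail x v []      l′ = refl
inv-tail x v (i ∷ l) l′ = trans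
  (length-filter-++ (inv? (x ∷ v)) (map (Fin.suc i ,_) (map Fin.suc l′)) _)
  (trans (cong₂ _+_
           (trans (length-filter-map (inv? (x ∷ v)) _ (map Fin.suc l′))
             (trans (length-filter-map (inv? (x ∷ v) ∘ (Fin.suc i ,_)) Fin.suc l′)
               (trans (cong length (List.filter-≐ _ (inv? v ∘ (i ,_))
                                     ((λ (p , q) → ℕ.≤-pred p , q) , (λ (p , q) → s≤s p , q)) l′))
                 (sym (length-filter-map (inv? v) (i ,_) l′)))))
           (inv-tail x v l l′))
    (sym (length-filter-++ (inv? v) (map (i ,_) l′) _)))

allFin-suc : ∀ m → allFin (suc m) ≡ Fin.zero ∷ map Fin.suc (allFin m)
allFin-suc m = cong (Fin.zero ∷_) (sym (List.map-tabulate id Fin.suc))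

opaque
  unfolding smaller
  inv-head : ∀ {s m} x (v : Word m (s * 3)) →
    length (filter (inv? (x ∷ v)) (map (Fin.zero ,_) (map Fin.suc (allFin m))))
    ≡ smaller (cell {s} x) (cells {s} v)
  inv-head {s} {m} x v = begin
    length (filter (inv? (x ∷ v)) (map (Fin.zero ,_) (map Fin.suc (allFin m))))
      ≡⟨ length-filter-map (inv? (x ∷ v)) _ (map Fin.suc (allFin m)) ⟩
    length (filter (inv? (x ∷ v) ∘ (Fin.zero ,_)) (map Fin.suc (allFin m)))
      ≡⟨ length-filter-map (inv? (x ∷ v) ∘ (Fin.zero ,_)) Fin.suc (allFin m) ⟩
    length (filter (λ j → inv? (x ∷ v) (Fin.zero , Fin.suc j)) (allFin m))
      ≡⟨ cong length (List.filter-≐ _ (smaller? ∘ (cell {s} ∘ lookup v))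
           ((λ {j} (_ , p) → subst₂ _<_ (sym (value-cell {s} (lookup v j))) (sym (value-cell {s} x)) p)
           , (λ {j} p → z<s , subst₂ _<_ (value-cell {s} (lookup v j)) (value-cell {s} x) p)) (allFin m)) ⟩
    length (filter (smaller? ∘ (cell {s} ∘ lookup v)) (allFin m))
      ≡⟨ length-filter-map smaller? (cell {s} ∘ lookup v) (allFin m) ⟨
    length (filter smaller? (map (cell {s} ∘ lookup v) (allFin m)))
      ≡⟨ cong (length ∘ filter smaller?) (List.map-tabulate id (cell {s} ∘ lookup v)) ⟩
    smaller (cell {s} x) (cells {s} v) ∎
    where
    open ≡-Reasoning
    smaller? : Decidable (λ c → value c < value (cell {s} x))
    smaller? c = value c ℕ.<? value (cell {s} x)

inv-cells : ∀ {s m} (v : Word m (s * 3)) →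
  length (filter (inv? v) (cartesianProduct (allFin m) (allFin m))) ≡ inversions (cells {s} v)
inv-cells         []      = refl
inv-cells {s} {suc m} (x ∷ v) = begin
  length (filter (inv? (x ∷ v)) (cartesianProduct (allFin (suc m)) (allFin (suc m))))
    ≡⟨ cong (λ l → length (filter (inv? (x ∷ v)) (cartesianProduct l l))) (allFin-suc m) ⟩
  -- The pair of `Fin.zero` with itself has been filtered out by computation.
  length (filter (inv? (x ∷ v)) (map (Fin.zero ,_) (map Fin.suc (allFin m)) ++ rest))
    ≡⟨ length-filter-++ (inv? (x ∷ v)) (map (Fin.zero ,_) (map Fin.suc (allFin m))) rest ⟩
  length (filter (inv? (x ∷ v)) (map (Fin.zero ,_) (map Fin.suc (allFin m)))) +
  length (filter (inv? (x ∷ v)) rest)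
    ≡⟨ cong₂ _+_ (inv-head {s} x v) (trans (inv-tail x v (allFin m) (allFin m)) (inv-cells {s} v)) ⟩
  inversions (cells {s} (x ∷ v)) ∎
  where
  open ≡-Reasoning
  rest = cartesianProduct (map Fin.suc (allFin m)) (Fin.zero ∷ map Fin.suc (allFin m))

-- Linear extensions avoiding 2143 are the runs of the automaton

Valid : ∀ s → Word (s * 3) (s * 3) → Set
Valid s π = IsLinearExtension s 3 π × Avoids pattern2143 π

before-trans : ∀ {n} {π : Word n n} {a b c} → IsPermutation π → Before π a b → Before π b c → Before π a c
before-trans perm (i , j , i<j , πi , πj) (k , l , k<l , πk , πl) =
  i , l , Fin.<-trans i<j (subst (Fin._< l) (proj₁ perm (trans πk (sym πj))) k<l) , πi , πl

before-total : ∀ {n} {π : Word n n} {a b} → IsPermutation π → a ≢ b → Before π a b ⊎ Before π b a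
before-total {a = a} {b} (_ , surj) a≢b with surj a | surj b
... | i , πi | j , πj with Fin.<-cmp i j
... | tri< i<j _ _  = inj₁ (i , j , i<j , πi refl , πj refl)
... | tri≈ _ refl _ = contradiction (trans (sym (πi refl)) (πj refl)) a≢b
... | tri> _ _ j<i  = inj₂ (j , i , j<i , πj refl , πi refl)

before-asym : ∀ {n} {π : Word n n} {a b} → IsPermutation π → Before π a b → ¬ Before π b a
before-asym perm (i , j , i<j , πi , πj) (k , l , k<l , πk , πl) =
  Fin.<-asym i<j (subst₂ Fin._<_ (proj₁ perm (trans πk (sym πj))) (proj₁ perm (trans πl (sym πi))) k<l)

-- An occurrence is described by its letters because the order of the poset concerns labels.
-- Consecutive hypotheses share a letter, whose two positions coincide by injectivity.
contains-2143 : ∀ {n} {π : Word n n} {a b c d} → IsPermutation π →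
                a Fin.< b → b Fin.< c → c Fin.< d →
                Before π b a → Before π a d → Before π d c → Contains pattern2143 π
contains-2143 {π = π} {a} {b} {c} {d} perm a<b b<c c<d
              (e₀ , e₁ , e₀<e₁ , πe₀ , πe₁) (k , e₂ , k<e₂ , πk , πe₂) (l , e₃ , l<e₃ , πl , πe₃) =
  (e₀ ∷ e₁ ∷ e₂ ∷ e₃ ∷ []) , increasing , λ j l → mk⇔ (to j l) (from j l)
  where
  e₁<e₂ : e₁ Fin.< e₂
  e₁<e₂ = subst (Fin._< e₂) (proj₁ perm (trans πk (sym πe₁))) k<e₂
  e₂<e₃ : e₂ Fin.< e₃
  e₂<e₃ = subst (Fin._< e₃) (proj₁ perm (trans πl (sym πe₂))) l<e₃

  e : Word 4 _
  e = e₀ ∷ e₁ ∷ e₂ ∷ e₃ ∷ []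

  increasing : ∀ j l → j Fin.< l → lookup e j Fin.< lookup e l
  increasing 0F 1F _ = e₀<e₁
  increasing 0F 2F _ = ℕ.<-trans e₀<e₁ e₁<e₂
  increasing 0F 3F _ = ℕ.<-trans e₀<e₁ (ℕ.<-trans e₁<e₂ e₂<e₃)
  increasing 1F 2F _ = e₁<e₂
  increasing 1F 3F _ = ℕ.<-trans e₁<e₂ e₂<e₃
  increasing 2F 3F _ = e₂<e₃
  increasing 1F 1F (s≤s ())
  increasing 2F 1F (s≤s ())
  increasing 2F 2F (s≤s (s≤s ()))
  increasing 3F 1F (s≤s ())
  increasing 3F 2F (s≤s (s≤s ()))
  increasing 3F 3F (s≤s (s≤s (s≤s ())))

  letter : Fin 4 → Fin _
  letter 0F = a
  letter 1F = b
  letter 2F = c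
  letter 3F = d

  letter-mono : ∀ j l → j Fin.< l → letter j Fin.< letter l
  letter-mono 0F 1F _ = a<b
  letter-mono 0F 2F _ = ℕ.<-trans a<b b<c
  letter-mono 0F 3F _ = ℕ.<-trans a<b (ℕ.<-trans b<c c<d)
  letter-mono 1F 2F _ = b<c
  letter-mono 1F 3F _ = ℕ.<-trans b<c c<d
  letter-mono 2F 3F _ = c<d
  letter-mono 1F 1F (s≤s ())
  letter-mono 2F 1F (s≤s ())
  letter-mono 2F 2F (s≤s (s≤s ()))
  letter-mono 3F 1F (s≤s ())
  letter-mono 3F 2F (s≤s (s≤s ()))
  letter-mono 3F 3F (s≤s (s≤s (s≤s ())))

  -- A strictly increasing map between total orders reflects the order, so the comparisons required
  -- in both directions all come from `letter-mono`.
  letter-cancel : ∀ j l → letter j Fin.< letter l → j Fin.< l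
  letter-cancel j l lt with Fin.<-cmp j l
  ... | tri< j<l _ _  = j<l
  ... | tri≈ _ refl _ = contradiction lt (ℕ.<-irrefl refl)
  ... | tri> _ _ l<j  = contradiction lt (ℕ.<-asym (letter-mono l j l<j))

  letters : ∀ j → lookup π (lookup e j) ≡ letter (lookup pattern2143 j)
  letters 0F = πe₀
  letters 1F = πe₁
  letters 2F = πe₂
  letters 3F = πe₃

  to : ∀ j l → lookup π (lookup e j) Fin.< lookup π (lookup e l) →
       lookup pattern2143 j Fin.< lookup pattern2143 l
  to j l lt = letter-cancel _ _ (subst₂ Fin._<_ (letters j) (letters l) lt)
  from : ∀ j l → lookup pattern2143 j Fin.< lookup pattern2143 l →
         lookup π (lookup e j) Fin.< lookup π (lookup e l)
  from j l lt = subst₂ Fin._<_ (sym (letters j)) (sym (letters l)) (letter-mono _ _ lt)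

cell-<⁺ : ∀ {s} {x y : Fin (s * 3)} → x Fin.< y → value (cell {s} x) < value (cell {s} y)
cell-<⁺ {s} {x} {y} = subst₂ _<_ (sym (value-cell {s} x)) (sym (value-cell {s} y))

toℕ-surjective : ∀ {s i} → i < s → ∃ λ (k : Fin s) → toℕ k ≡ i
toℕ-surjective i<s = fromℕ< i<s , Fin.toℕ-fromℕ< i<s

combine-<-column : ∀ {s} (i : Fin s) {j j′ : Fin 3} → j Fin.< j′ → combine i j Fin.< combine i j′
combine-<-column i {j} {j′} j<j′ =
  subst₂ _<_ (sym (Fin.toℕ-combine i j)) (sym (Fin.toℕ-combine i j′)) (ℕ.+-monoʳ-< (3 * toℕ i) j<j′)

skip-before : ∀ {s π} → Valid s π → (i i₁ i₂ : Fin s) → toℕ i₁ ≡ suc (toℕ i) → toℕ i₂ ≡ suc (toℕ i₁) →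
              Before π (combine i₂ 2F) (combine i 0F)
skip-before {s} {π} ((perm , ext) , avoids) i i₁ i₂ eq₁ eq₂
  with before-total {π = π} perm
         (λ eq → ℕ.<-irrefl (cong toℕ (sym eq)) (Fin.combine-monoˡ-< {i = i} {i₂} 0F 2F
           (ℕ.<-trans (ℕ.≤-reflexive (sym eq₁)) (ℕ.≤-reflexive (sym eq₂)))))
... | inj₁ p = p
... | inj₂ p = contradiction
  -- Increasingly, the letters are `(i , 0)`, `(i₁ , 0)`, `(i₁ , 2)`, `(i₂ , 2)`; the column
  -- relations supply the two descents and `p` the link between them.
  (contains-2143 {π = π} perm
    (Fin.combine-monoˡ-< {i = i} {i₁} 0F 0F (ℕ.≤-reflexive (sym eq₁)))
    (combine-<-column i₁ {0F} {2F} z<s)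
    (Fin.combine-monoˡ-< {i = i₁} {i₂} 2F 2F (ℕ.≤-reflexive (sym eq₂)))
    (ext [ column i i₁ 0F eq₁ ]⁺) p (ext [ column i₁ i₂ 2F eq₂ ]⁺))
  avoids

valid⇒run : ∀ s {π} → Valid s π → Run (E s) (cells {s} π)
valid⇒run s {π} valid@(((inj , surj) , ext) , _) =
  -- Neither list repeats a cell, so equal membership already yields a permutation.
  run-complete (E s) _ unique (∼bag⇒↭ (unique∧set⇒bag unique (below-unique s) (mk⇔ to from))) respects
  where
  unique : Unique (cells {s} π)
  unique = Unique.tabulate⁺ (inj ∘ cell-injective {s})

  row< : ∀ {c} → c ∈ cells {s} π → proj₁ c < s
  row< c∈ with k , refl ← ∈-tabulate⁻ c∈ = cell-row< {s} (lookup π k)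

  to : ∀ {c} → c ∈ cells {s} π → c ∈ below s
  to c∈ = <⇒∈-below s _ (row< c∈)

  from : ∀ {c} → c ∈ below s → c ∈ cells {s} π
  from {i , j} c∈ with x , refl ← cell-surjective {s} j (∈-below⇒< s c∈) with k , πk ← surj x =
    subst (λ y → cell {s} y ∈ cells {s} π) (πk refl) (∈-tabulate⁺ k)

  precedes : ∀ {i i′ : Fin s} {j j′} → Before π (combine i j) (combine i′ j′) →
             Precedes (toℕ i , j) (toℕ i′ , j′) (cells {s} π)
  precedes {i} {i′} {j} {j′} b =
    subst₂ (λ c c′ → Precedes c c′ (cells {s} π)) (cell-combine i j) (cell-combine i′ j′)
      (before⇒precedes {s} {v = π} b)

  respects : ∀ {a b} → a ∈ cells {s} π → b ∈ cells {s} π → Gen a b → Precedes a b (cells {s} π)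
  respects a∈ b∈ (row {i} {j} {j′} eq)
    with k , refl ← toℕ-surjective (row< a∈) = precedes (ext [ row k j j′ eq ]⁺)
  respects a∈ b∈ (column {i} {j})
    with k′ , k′≡ ← toℕ-surjective (row< a∈) | k , refl ← toℕ-surjective (row< b∈) =
    subst (λ i → Precedes (i , j) (toℕ k , j) (cells {s} π)) k′≡ (precedes (ext [ column k k′ j k′≡ ]⁺))
  respects a∈ b∈ (skip {i})
    -- The middle row contains neither cell of `skip` but is needed for the pattern; it is in range
    -- because the row above it is.
    with k₂ , k₂≡ ← toℕ-surjective (row< a∈)
       | k₁ , k₁≡ ← toℕ-surjective (ℕ.<-trans (ℕ.n<1+n (suc i)) (row< a∈))
       | k , refl ← toℕ-surjective (row< b∈) =
    subst (λ i → Precedes (i , 2F) (toℕ k , 0F) (cells {s} π)) k₂≡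
      (precedes (skip-before {s} {π} valid k k₁ k₂ k₁≡ (trans k₂≡ (cong suc (sym k₁≡)))))

run⇒valid : ∀ s {π} → Run (E s) (cells {s} π) → Valid s π
run⇒valid s {π} r = (perm , extends) , avoids
  where
  ∈-cells : ∀ x → cell {s} x ∈ cells {s} π
  ∈-cells x = ∈-resp-↭ (↭-sym (run-↭ r)) (<⇒∈-below s _ (cell-row< {s} x))

  perm : IsPermutation π
  perm = (λ eq → unique-tabulate⇒injective
                   (Setoid.Unique-resp-↭ (setoid Cell) (↭⇒↭ₛ (↭-sym (run-↭ r))) (below-unique s))
                   (cong (cell {s}) eq))
       , λ x → let k , eq = ∈-tabulate⁻ (∈-cells x) in k , λ { refl → sym (cell-injective {s} eq) }

  before : ∀ x y → Prec (cell {s} x) (cell {s} y) → Before π x y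
  before x y x<y = precedes⇒before {s} {v = π} (run-respects r (∈-cells x) (∈-cells y) x<y)

  gen : ∀ {a b} → ENGen s 3 a b → Before π a b
  gen (row i j j′ eq) = before _ _
    (subst₂ Prec (sym (cell-combine i j)) (sym (cell-combine i j′)) (row (ℕ.≤-reflexive (sym eq))))
  gen (column i i′ j eq) = before _ _
    (subst₂ Prec (trans (cong (_, j) (sym eq)) (sym (cell-combine i′ j))) (sym (cell-combine i j)) column)

  extends : ∀ {a b} → EN< s 3 a b → Before π a b
  extends [ a<b ]⁺     = gen a<b
  extends (a<b ∷⁺ b<c) = before-trans {π = π} perm (gen a<b) (extends b<c)

  -- Labels of one row appear in increasing order, so an inversion cannot lie within a row.
  inversion⇒row : ∀ {x y} → Before π y x → x Fin.< y → proj₁ (cell {s} x) < proj₁ (cell {s} y)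
  inversion⇒row {x} {y} y<x x<y with value-<⇒ (cell-<⁺ {s} x<y)
  ... | inj₁ lt        = lt
  ... | inj₂ (eq , lt) = contradiction
    (before x y (prec (cell {s} x) (cell {s} y) eq lt)) (before-asym {π = π} perm y<x)
    where
    prec : ∀ a b → proj₁ a ≡ proj₁ b → proj₂ a Fin.< proj₂ b → Prec a b
    prec _ _ refl = row

  avoids : Avoids pattern2143 π
  avoids (e , increasing , ordered) = before-asym {π = π} perm
    (before d a (far (ℕ.<-≤-trans (s≤s (inversion⇒row (at 0F 1F z<s) (<-at 1F 0F z<s)))
                       (ℕ.≤-<-trans b≤c (inversion⇒row (at 2F 3F (s≤s (s≤s (s≤s z≤n))))
                         (<-at 3F 2F (s≤s (s≤s (s≤s z≤n)))))))))
    (at 1F 2F (s≤s (s≤s z≤n)))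
    where
    -- The names follow the size of the letters, while the positions spell `badc`.
    a = lookup π (lookup e 1F)
    b = lookup π (lookup e 0F)
    c = lookup π (lookup e 3F)
    d = lookup π (lookup e 2F)
    at : ∀ j l → j Fin.< l → Before π (lookup π (lookup e j)) (lookup π (lookup e l))
    at j l j<l = lookup e j , lookup e l , increasing j l j<l , refl , refl
    <-at : ∀ j l → lookup pattern2143 j Fin.< lookup pattern2143 l →
           lookup π (lookup e j) Fin.< lookup π (lookup e l)
    <-at j l = Equivalence.from (ordered j l)
    b≤c : proj₁ (cell {s} b) ≤ proj₁ (cell {s} c)
    b≤c with value-<⇒ (cell-<⁺ {s} (<-at 0F 3F (s≤s (s≤s z≤n))))
    ... | inj₁ lt       = ℕ.<⇒≤ lt
    ... | inj₂ (eq , _) = ℕ.≤-reflexive eq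

-- Comparison of the two enumerations

words-unique : ∀ m n → Unique (words m n)
words-unique zero    n = [] ∷ []
words-unique (suc m) n = Unique.cartesianProductWith⁺ _∷_ Vec.∷-injective (Unique.allFin⁺ n) (words-unique m n)

-- Coefficients are insensitive to the order of terms but not to multiplicity. The absence of
-- repetitions on both sides therefore lets the equivalence of membership suffice.
EN-cells : ∀ s → map (cells {s}) (EN s 3 pattern2143) ↭ runs (s * 3) (E s)
EN-cells s = ∼bag⇒↭ (unique∧set⇒bag
  (Unique.map⁺ (cells-injective {s}) (Unique.filter⁺ valid? (words-unique (s * 3) (s * 3))))
  (runs-unique (s * 3) (E s)) (mk⇔ to from))
  where
  valid? : Decidable (Valid s)
  valid? π = isLinearExtension? s 3 π ×-dec avoids? pattern2143 π

  to : ∀ {w} → w ∈ map (cells {s}) (EN s 3 pattern2143) → w ∈ runs (s * 3) (E s)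
  to w∈ with π , π∈ , refl ← ∈-map⁻ (cells {s}) w∈ =
    subst (λ k → cells {s} π ∈ runs k (E s)) (List.length-tabulate (cell {s} ∘ lookup π))
      (∈-runs⁺ (valid⇒run s {π} (proj₂ (∈-filter⁻ valid? {xs = words (s * 3) (s * 3)} π∈))))

  from : ∀ {w} → w ∈ runs (s * 3) (E s) → w ∈ map (cells {s}) (EN s 3 pattern2143)
  from {w} w∈
    with r ← ∈-runs⁻ (s * 3) (E s) w∈
    with π , refl ← cells-surjective {s} w (trans (↭-length (run-↭ r)) (length-below s))
                      (All.tabulate λ c∈ → ∈-below⇒< s (∈-resp-↭ (run-↭ r) c∈)) =
    ∈-map⁺ (cells {s}) (∈-filter⁺ valid? (∈-words π) (run⇒valid s {π} r))

EN-poly-cells : ∀ s → EN-poly s 3 pattern2143 ≡ inv-terms (map (cells {s}) (EN s 3 pattern2143))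
EN-poly-cells s = go (EN s 3 pattern2143)
  where
  go : ∀ πs → sumᴸ (map (λ π → q^ (+ inv π)) πs) ≡ inv-terms (map (cells {s}) πs)
  go []       = refl
  go (π ∷ πs) = cong₂ _∷_ (cong (λ k → 1ℤ , + k) (inv-cells {s} π)) (go πs)

theorem3p3 : ∀ (s : ℕ) → 1 ≤ s →
    EN-poly s 3 pattern2143 ≈ (q^ (+ (9 * (s C 2)))) *ᴸ evaluate (F s) (q^ -1ℤ)
theorem3p3 s@(suc m) _ e = begin
  coefficient (EN-poly s 3 pattern2143) e
    ≡⟨ cong (λ p → coefficient p e) (EN-poly-cells s) ⟩
  coefficient (inv-terms (map (cells {s}) (EN s 3 pattern2143))) e
    ≡⟨ coefficient-↭ (map⁺ _ (EN-cells s)) e ⟩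
  coefficient (inv-terms (runs (s * 3) (E s))) e
    ≡⟨ gf-E≡ m e ⟩
  coefficient ((q^ (+ (9 * (s C 2)))) *ᴸ evaluate (F s) (q^ -1ℤ)) e ∎
  where open ≡-Reasoning
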